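{- Let $r,c$ be odd positive integers and let $h$ be a white vertex of the $r\times c$ grid graph. Let $a(r,c;h)$ be the number of near-perfect matchings of the grid in which $h$ is unmatched. Then $a(r,c;h)$ is odd if and only if all three of the following hold: (i) at least one of $r$ or $c$ is congruent to $1$ mod $4$; (ii) $\gcd(r+1,c+1)=2$; and (iii) $h$ is odd.
   Context: The $r\times c$ grid graph has vertex set $\{1,\dots,r\}\times\{1,\dots,c\}$, with two vertices adjacent when they differ by $1$ in exactly one coordinate. A near-perfect matching is a set of pairwise disjoint edges covering all vertices but one. With $r,c$ odd, color the grid in checkerboard fashion; a vertex is white if it has the majority color (i.e. vertex $(i,j)$ is white iff $i+j$ is even), otherwise black. A white vertex $(i,j)$ (whose two coordinates then have the same parity) is called odd if $i$ and $j$ are odd and even if $i$ and $j$ are even; in particular all white vertices on the boundary are odd. -}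

module Defs where

open import Data.Nat using (ℕ; zero; suc; _+_; _%_)
open import Data.Nat.Properties using (_≟_)
open import Data.Fin using (Fin; toℕ)
open import Data.Fin.Properties using () renaming (_≟_ to _≟ᶠ_)
open import Data.List using (List; []; _∷_; map; _++_; filter; length; allFin; cartesianProduct; concatMap)
open import Data.List.Relation.Unary.All using (All; all?)
open import Data.Product using (_×_; _,_; proj₁; proj₂)
open import Data.Product.Properties using (≡-dec)
open import Data.Sum using (_⊎_)
open import Relation.Binary.PropositionalEquality using (_≡_)
open import Relation.Nullary using (Dec; yes; no)
open import Relation.Nullary.Decidable using (_⊎-dec_; _×-dec_)

-- Vertices of the r × c grid graph.  Coordinates are 0-indexed here:
-- the 0-indexed vertex (i , j) is the paper's vertex (i+1 , j+1).
Vertex : ℕ → ℕ → Set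
Vertex r c = Fin r × Fin c

_≟ᵛ_ : ∀ {r c} (u v : Vertex r c) → Dec (u ≡ v)
_≟ᵛ_ = ≡-dec _≟ᶠ_ _≟ᶠ_

allVertices : ∀ r c → List (Vertex r c)
allVertices r c = cartesianProduct (allFin r) (allFin c)

-- An (undirected) edge is stored once, as an ordered pair (u , v) with v
-- the right or lower neighbour of u.
Edge : ℕ → ℕ → Set
Edge r c = Vertex r c × Vertex r c

Step : ∀ {r c} → Vertex r c → Vertex r c → Set
Step (i , j) (i' , j') =
  (i ≡ i' × toℕ j' ≡ suc (toℕ j)) ⊎ (j ≡ j' × toℕ i' ≡ suc (toℕ i))

step? : ∀ {r c} (u v : Vertex r c) → Dec (Step u v)
step? (i , j) (i' , j') =
  ((i ≟ᶠ i') ×-dec (toℕ j' ≟ suc (toℕ j))) ⊎-dec ((j ≟ᶠ j') ×-dec (toℕ i' ≟ suc (toℕ i)))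

gridEdges : ∀ r c → List (Edge r c)
gridEdges r c =
  filter (λ e → step? (proj₁ e) (proj₂ e))
         (cartesianProduct (allVertices r c) (allVertices r c))

sublists : ∀ {A : Set} → List A → List (List A)
sublists [] = [] ∷ []
sublists (x ∷ xs) = let s = sublists xs in s ++ map (x ∷_) s

degree : ∀ {r c} → List (Edge r c) → Vertex r c → ℕ
degree M v = length (filter (λ e → (proj₁ e ≟ᵛ v) ⊎-dec (proj₂ e ≟ᵛ v)) M)

targetDegree : ∀ {r c} → Vertex r c → Vertex r c → ℕ
targetDegree h v with v ≟ᵛ h
... | yes _ = 0
... | no _ = 1

IsNearPerfectMissing : ∀ {r c} → Vertex r c → List (Edge r c) → Set
IsNearPerfectMissing {r} {c} h M =
  All (λ v → degree M v ≡ targetDegree h v) (allVertices r c)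

isNearPerfectMissing? : ∀ {r c} (h : Vertex r c) (M : List (Edge r c)) →
  Dec (IsNearPerfectMissing h M)
isNearPerfectMissing? {r} {c} h M =
  all? (λ v → degree M v ≟ targetDegree h v) (allVertices r c)

a : ∀ r c → Vertex r c → ℕ
a r c h = length (filter (isNearPerfectMissing? h) (sublists (gridEdges r c)))

-- white: i + j even (parity is the same in 0- and 1-indexed coordinates)
White : ∀ {r c} → Vertex r c → Set
White (i , j) = (toℕ i + toℕ j) % 2 ≡ 0

-- odd white vertex: both (1-indexed) coordinates odd
OddVertex : ∀ {r c} → Vertex r c → Set
OddVertex (i , j) = suc (toℕ i) % 2 ≡ 1 × suc (toℕ j) % 2 ≡ 1

{-# OPTIONS --safe #-}
module Submission where

-- In Λ = 𝔽₂[x_v]/(x_v²) the parity of a(r,c;h) is the coefficient of Π_{v ≠ h} x_v in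
-- Π_{uv an edge} (1 + x_u x_v), a Pfaffian modulo 2.  Eliminating one variable at a time shows
-- that it is 1 exactly when the adjacency matrix of the grid without h is nonsingular over 𝔽₂.
-- A kernel vector is, after extension by zero, a function on [0, r + 1] × [0, c + 1] which
-- vanishes on the boundary and at h and whose sum over the neighbours of every interior point
-- other than h is 0.  The indicator oddOdd of the odd vertices always has sum 0 over neighbours.
-- If h is not odd, it is a kernel vector; if h is odd, pairing with it shows that the sum at h
-- vanishes as well.  When g = gcd(r + 1, c + 1) > 2, billiard trajectories in a g × g square give
-- a second solution independent of oddOdd, hence a combination vanishing at h.  When g = 2,
-- Euclid's algorithm on the side lengths reduces every solution to one on a 2 × 2 square, so that
-- it is a multiple of oddOdd, and zero if it vanishes at an odd h; squares can be cut off because a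
-- solution on a square that vanishes on two adjacent sides is symmetric about the diagonal through
-- their common corner, so that a third zero side forces the fourth.  Condition (i) follows from (ii).

open import Algebra.Bundles using (CommutativeRing)
import Algebra.Construct.DirectProduct as DirectProduct
import Algebra.Properties.Group as GroupProperties
import Algebra.Solver.Ring as RingSolver
import Algebra.Solver.Ring.AlmostCommutativeRing as ACR
open import Data.Bool using (Bool; true; false; not; _∧_; _∨_; _xor_; if_then_else_; T; T?)
open import Data.Bool.Properties
  using (not-involutive; not-injective; not-¬; not-distribˡ-xor; xor-assoc; xor-comm; xor-same;
         xor-identityʳ; xor-∧-commutativeRing; ∧-assoc; ∧-comm; ∧-identityʳ; ∧-zeroʳ; ∨-identityʳ; ∨-zeroʳ)
open import Data.List using (List; []; _∷_; _++_; map)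
open import Data.List.Membership.Propositional using (_∈_)
open import Data.List.Relation.Binary.Permutation.Propositional as ↭ using (_↭_; ↭-sym; ↭⇒↭ₛ)
open import Data.List.Relation.Unary.All as All using (All; []; _∷_)
open import Data.List.Relation.Unary.Any using (here; there)
open import Data.Maybe using (Maybe; just; nothing)
open import Data.Product using (_×_; _,_; proj₁; proj₂; ∃; ∃₂)
open import Level using (0ℓ)
open import Relation.Binary.PropositionalEquality as ≡ using (_≡_)
import Relation.Binary.Reasoning.Setoid as SetoidReasoning

-- Commutative rings of characteristic 2

HasCharacteristic2 : CommutativeRing 0ℓ 0ℓ → Set
HasCharacteristic2 R = 1# + 1# ≈ 0#
  where open CommutativeRing R

module Characteristic2 (R : CommutativeRing 0ℓ 0ℓ) (1+1≈0 : HasCharacteristic2 R) where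

  open CommutativeRing R

  ι : Bool → Carrier
  ι true = 1#
  ι false = 0#

  ι-+ : ∀ a b → ι (a xor b) ≈ ι a + ι b
  ι-+ true true = sym 1+1≈0
  ι-+ true false = sym (+-identityʳ 1#)
  ι-+ false b = sym (+-identityˡ (ι b))

  ι-* : ∀ a b → ι (a ∧ b) ≈ ι a * ι b
  ι-* true b = sym (*-identityˡ (ι b))
  ι-* false b = sym (zeroˡ (ι b))

  x+x≈0 : ∀ x → x + x ≈ 0#
  x+x≈0 x = trans (+-cong (sym (*-identityˡ x)) (sym (*-identityˡ x)))
    (trans (sym (distribʳ x 1# 1#)) (trans (*-congʳ 1+1≈0) (zeroˡ x)))

  almost : ACR.AlmostCommutativeRing 0ℓ 0ℓ
  almost = ACR.fromCommutativeRing R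

  -- With `Bool` as coefficient ring the solver cancels x + x by itself. Negation in `Bool` is the
  -- identity, hence the appeal to `x+x≈0`.
  coefficients : ACR._-Raw-AlmostCommutative⟶_
    (CommutativeRing.rawRing xor-∧-commutativeRing) almost
  coefficients = record
    { ⟦_⟧ = ι
    ; +-homo = ι-+
    ; *-homo = ι-*
    ; -‿homo = λ b → GroupProperties.inverseˡ-unique +-group (ι b) (ι b) (x+x≈0 (ι b))
    ; 0-homo = refl
    ; 1-homo = refl
    }

  coefficient-≟ : ∀ a b → Maybe (ι a ≈ ι b)
  coefficient-≟ true true = just refl
  coefficient-≟ false false = just refl
  coefficient-≟ _ _ = nothing

  module Solver = RingSolver (CommutativeRing.rawRing xor-∧-commutativeRing)
    almost coefficients coefficient-≟

module _ (R : CommutativeRing 0ℓ 0ℓ) (1+1≈0 : HasCharacteristic2 R) where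

  open CommutativeRing R
  open Characteristic2 R 1+1≈0
  open Solver

  -- The pair `(a , b)` stands for a + b x with x² = 0.
  Dual : CommutativeRing 0ℓ 0ℓ
  Dual = record
    { Carrier = Carrier × Carrier
    ; _≈_ = _
    ; _*_ = λ (a , b) (c , d) → a * c , a * d + b * c
    ; 1# = 1# , 0#
    ; isCommutativeRing = record
      { isRing = record
        { +-isAbelianGroup = CommutativeRing.+-isAbelianGroup (DirectProduct.commutativeRing R R)
        ; *-cong = λ (p , p′) (q , q′) → *-cong p q , +-cong (*-cong p q′) (*-cong p′ q)
        ; *-assoc = λ (a , b) (c , d) (e , f) → *-assoc a c e ,
            solve 6 (λ a b c d e f → (a :* c) :* f :+ (a :* d :+ b :* c) :* e
              := a :* (c :* f :+ d :* e) :+ b :* (c :* e)) refl a b c d e f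
        ; *-identity = (λ (a , b) → *-identityˡ a ,
              trans (+-cong (*-identityˡ b) (zeroˡ a)) (+-identityʳ b))
          , (λ (a , b) → *-identityʳ a ,
              trans (+-cong (zeroʳ a) (*-identityʳ b)) (+-identityˡ b))
        ; distrib = (λ (a , b) (c , d) (e , f) → distribˡ a c e ,
              solve 6 (λ a b c d e f → a :* (d :+ f) :+ b :* (c :+ e)
                := (a :* d :+ b :* c) :+ (a :* f :+ b :* e)) refl a b c d e f)
          , (λ (a , b) (c , d) (e , f) → distribʳ a c e ,
              solve 6 (λ a b c d e f → (c :+ e) :* b :+ (d :+ f) :* a
                := (c :* b :+ d :* a) :+ (e :* b :+ f :* a)) refl a b c d e f)
        }
      ; *-comm = λ (a , b) (c , d) → *-comm a c ,
          solve 4 (λ a b c d → a :* d :+ b :* c := c :* b :+ d :* a) refl a b c d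
      }
    }

  Dual-1+1≈0 : HasCharacteristic2 Dual
  Dual-1+1≈0 = 1+1≈0 , +-identityˡ 0#

-- The algebra 𝔽₂[x_v]/(x_v²), as iterated dual numbers

𝔽₂ : CommutativeRing 0ℓ 0ℓ
𝔽₂ = xor-∧-commutativeRing

module _ {V : Set} where

  mutual
    Λ : List V → CommutativeRing 0ℓ 0ℓ
    Λ [] = 𝔽₂
    Λ (v ∷ L) = Dual (Λ L) (Λ-1+1≈0 L)

    Λ-1+1≈0 : ∀ L → HasCharacteristic2 (Λ L)
    Λ-1+1≈0 [] = ≡.refl
    Λ-1+1≈0 (v ∷ L) = Dual-1+1≈0 (Λ L) (Λ-1+1≈0 L)

  module Ring (L : List V) where
    open CommutativeRing (Λ L) public
    open Characteristic2 (Λ L) (Λ-1+1≈0 L) public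
    open SetoidReasoning setoid public

  ∣Λ_∣ : List V → Set
  ∣Λ L ∣ = CommutativeRing.Carrier (Λ L)

  -- The linear form Σ_v l(v) x_v.
  lin : ∀ L → (V → Bool) → ∣Λ L ∣
  lin [] l = false
  lin (v ∷ L) l = lin L l , Ring.ι L (l v)

  -- The product of 1 + q(u,v) x_u x_v over all pairs of positions in L.
  exp : ∀ L → (V → V → Bool) → ∣Λ L ∣
  exp [] q = true
  exp (v ∷ L) q = exp L q , exp L q * lin L (q v)
    where open Ring L

  lin-cong : ∀ L {l m} → (∀ {x} → x ∈ L → l x ≡ m x) → let open Ring L in lin L l ≈ lin L m
  lin-cong [] eq = ≡.refl
  lin-cong (v ∷ L) eq = lin-cong L (λ x∈L → eq (there x∈L)) , reflexive (≡.cong ι (eq (here ≡.refl)))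
    where open Ring L

  lin-0 : ∀ L {l} → (∀ {x} → x ∈ L → l x ≡ false) → let open Ring L in lin L l ≈ 0#
  lin-0 [] eq = ≡.refl
  lin-0 (v ∷ L) eq = lin-0 L (λ x∈L → eq (there x∈L)) , reflexive (≡.cong ι (eq (here ≡.refl)))
    where open Ring L

  lin-+ : ∀ L l m → let open Ring L in lin L (λ x → l x xor m x) ≈ lin L l + lin L m
  lin-+ [] l m = ≡.refl
  lin-+ (v ∷ L) l m = lin-+ L l m , Ring.ι-+ L (l v) (m v)

  lin-* : ∀ L c l → let open Ring L in lin L (λ x → c ∧ l x) ≈ ι c * lin L l
  lin-* L true l = sym (*-identityˡ (lin L l))
    where open Ring L
  lin-* L false l = trans (lin-0 L (λ _ → ≡.refl)) (sym (zeroˡ (lin L l)))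
    where open Ring L

  -- Every variable has square 0, and each mixed term occurs twice.
  lin² : ∀ L l → let open Ring L in lin L l * lin L l ≈ 0#
  lin² [] l = ≡.refl
  lin² (v ∷ L) l = lin² L l ,
    solve 2 (λ a b → a :* b :+ b :* a := con false) refl (lin L l) (ι (l v))
    where
    open Ring L
    open Solver

  exp-cong : ∀ L {q q′} → (∀ {x y} → x ∈ L → y ∈ L → q x y ≡ q′ x y) →
    let open Ring L in exp L q ≈ exp L q′
  exp-cong [] eq = ≡.refl
  exp-cong (v ∷ L) {q} {q′} eq = ih , *-cong ih (lin-cong L (λ y∈L → eq (here ≡.refl) (there y∈L)))
    where
    open Ring L
    ih = exp-cong L (λ x∈L y∈L → eq (there x∈L) (there y∈L))

  -- Holds factor by factor: (1 + s x_u x_v)(1 + t x_u x_v) = 1 + (s + t) x_u x_v, because x_u² = 0.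
  exp-+ : ∀ L q q′ → let open Ring L in
    exp L (λ x y → q x y xor q′ x y) ≈ exp L q * exp L q′
  exp-+ [] q q′ = ≡.refl
  exp-+ (v ∷ L) q q′ = exp-+ L q q′ , (begin
    exp L (λ x y → q x y xor q′ x y) * lin L (λ y → q v y xor q′ v y)
      ≈⟨ *-cong (exp-+ L q q′) (lin-+ L (q v) (q′ v)) ⟩
    (exp L q * exp L q′) * (lin L (q v) + lin L (q′ v))
      ≈⟨ solve 4 (λ e e′ m m′ → (e :* e′) :* (m :+ m′) := e :* (e′ :* m′) :+ (e :* m) :* e′)
           refl (exp L q) (exp L q′) (lin L (q v)) (lin L (q′ v)) ⟩
    exp L q * (exp L q′ * lin L (q′ v)) + (exp L q * lin L (q v)) * exp L q′ ∎)
    where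
    open Ring L
    open Solver

  wedge : (V → Bool) → (V → Bool) → V → V → Bool
  wedge l m x y = (l x ∧ m y) xor (m x ∧ l y)

  -- `wedge l m` lists the coefficients of the product of the two linear forms. Terms of higher
  -- order contain the square of one of them and vanish by `lin²`.
  exp-wedge : ∀ L l m → let open Ring L in exp L (wedge l m) ≈ 1# + lin L l * lin L m
  exp-wedge [] l m = ≡.refl
  exp-wedge (v ∷ L) l m = exp-wedge L l m , (begin
    exp L (wedge l m) * lin L (wedge l m v)
      ≈⟨ *-cong (exp-wedge L l m) (trans (lin-+ L _ _) (+-cong (lin-* L (l v) m) (lin-* L (m v) l))) ⟩
    (1# + p * q) * (a * q + b * p)
      ≈⟨ solve 4 (λ p q a b → (con true :+ p :* q) :* (a :* q :+ b :* p)
           := (p :* b :+ a :* q) :+ (a :* p) :* (q :* q) :+ (b :* q) :* (p :* p)) refl p q a b ⟩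
    (p * b + a * q) + (a * p) * (q * q) + (b * q) * (p * p)
      ≈⟨ +-cong (+-congˡ (*-congˡ (lin² L m))) (*-congˡ (lin² L l)) ⟩
    (p * b + a * q) + (a * p) * 0# + (b * q) * 0#
      ≈⟨ solve 4 (λ p q a b → (p :* b :+ a :* q) :+ (a :* p) :* con false :+ (b :* q) :* con false
           := con false :+ (p :* b :+ a :* q)) refl p q a b ⟩
    0# + (p * b + a * q) ∎)
    where
    open Ring L
    open Solver
    p = lin L l
    q = lin L m
    a = ι (l v)
    b = ι (m v)

  -- The coefficient of the monomial Π_{v ∈ L, S v} x_v.
  coef : ∀ L → (V → Bool) → ∣Λ L ∣ → Bool
  coef [] S b = b
  coef (v ∷ L) S (a , b) = if S v then coef L S b else coef L S a

  coef-cong : ∀ L S {p p′} → let open Ring L in p ≈ p′ → coef L S p ≡ coef L S p′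
  coef-cong [] S eq = eq
  coef-cong (v ∷ L) S (eq , eq′) with S v
  ... | true = coef-cong L S eq′
  ... | false = coef-cong L S eq

  coef-+ : ∀ L S p p′ → let open Ring L in coef L S (p + p′) ≡ coef L S p xor coef L S p′
  coef-+ [] S p p′ = ≡.refl
  coef-+ (v ∷ L) S (a , b) (a′ , b′) with S v
  ... | true = coef-+ L S b b′
  ... | false = coef-+ L S a a′

  linProduct : ∀ L → (V → V → Bool) → List V → ∣Λ L ∣
  linProduct L q [] = CommutativeRing.1# (Λ L)
  linProduct L q (b ∷ bs) = lin L (q b) * linProduct L q bs
    where open Ring L

  linProduct-↭ : ∀ L q {bs bs′} → bs ↭ bs′ → let open Ring L in
    linProduct L q bs ≈ linProduct L q bs′
  linProduct-↭ L q _↭_.refl = Ring.refl L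
  linProduct-↭ L q (_↭_.prep b σ) = *-congˡ (linProduct-↭ L q σ)
    where open Ring L
  linProduct-↭ L q (_↭_.swap {_} {bs′} b c σ) = trans (*-congˡ (*-congˡ (linProduct-↭ L q σ)))
    (solve 3 (λ p q r → p :* (q :* r) := q :* (p :* r)) refl (lin L (q b)) (lin L (q c)) (linProduct L q bs′))
    where
    open Ring L
    open Solver
  linProduct-↭ L q (_↭_.trans σ τ) = Ring.trans L (linProduct-↭ L q σ) (linProduct-↭ L q τ)

  -- The Pfaffian, modulo 2, of q on the vertices of L selected by S together with bs,
  -- provided that q vanishes on bs × bs.
  pf : ∀ L → (V → Bool) → (V → V → Bool) → List V → Bool
  pf L S q bs = coef L S (exp L q * linProduct L q bs)
    where open Ring L

  linProduct-proj₁ : ∀ v L q bs → let open Ring L in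
    proj₁ (linProduct (v ∷ L) q bs) ≈ linProduct L q bs
  linProduct-proj₁ v L q [] = Ring.refl L
  linProduct-proj₁ v L q (b ∷ bs) = *-congˡ (linProduct-proj₁ v L q bs)
    where open Ring L

  pf-↭ : ∀ L S q {bs bs′} → bs ↭ bs′ → pf L S q bs ≡ pf L S q bs′
  pf-↭ L S q σ = coef-cong L S (Ring.*-congˡ L (linProduct-↭ L q σ))

  pf-skip : ∀ v L S q bs → S v ≡ false → pf (v ∷ L) S q bs ≡ pf L S q bs
  pf-skip v L S q bs Sv rewrite Sv = coef-cong L S (Ring.*-congˡ L (linProduct-proj₁ v L q bs))

  -- The x_v part of `exp (v ∷ L) q` is `exp L q * lin L (q v)`, and the forms of `bs` do not
  -- contain x_v. So the form of `v` joins the product.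
  pf-move : ∀ v L S q bs → S v ≡ true → All (λ b → q b v ≡ false) bs →
    pf (v ∷ L) S q bs ≡ pf L S q (v ∷ bs)
  pf-move v L S q bs Sv bs⊥v rewrite Sv = coef-cong L S (begin
    e * proj₂ (linProduct (v ∷ L) q bs) + (e * m) * proj₁ (linProduct (v ∷ L) q bs)
      ≈⟨ +-cong (*-congˡ (proj₂≈0 bs bs⊥v)) (*-congˡ (linProduct-proj₁ v L q bs)) ⟩
    e * 0# + (e * m) * p
      ≈⟨ solve 3 (λ e m p → e :* con false :+ (e :* m) :* p := e :* (m :* p)) refl e m p ⟩
    e * (m * p) ∎)
    where
    open Ring L
    open Solver
    e = exp L q
    m = lin L (q v)
    p = linProduct L q bs
    proj₂≈0 : ∀ bs → All (λ b → q b v ≡ false) bs → proj₂ (linProduct (v ∷ L) q bs) ≈ 0#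
    proj₂≈0 [] [] = refl
    proj₂≈0 (b ∷ bs) (b⊥v ∷ bs⊥v) = trans
      (+-cong (*-congˡ (proj₂≈0 bs bs⊥v)) (*-congʳ (reflexive (≡.cong ι b⊥v))))
      (solve 2 (λ x y → x :* con false :+ con false :* y := con false) refl
        (lin L (q b)) (proj₁ (linProduct (v ∷ L) q bs)))

  -- Symmetric Gaussian elimination of the rows and columns b and v.
  eliminate : (V → V → Bool) → V → V → V → V → Bool
  eliminate q b v x y = q x y xor wedge (q b) (q v) x y

  -- Write l and m for the forms of `b` and `v`, e for `exp L q`, and P + x_v Q for the product over
  -- `bs`. The x_v part of e (1 + x_v m)(l + x_v)(P + x_v Q) is e (P + l Q + l m P), which equals e
  -- (1 + l m)(P + l Q) because l² = 0. By `exp-wedge` the factor 1 + l m turns e into the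
  -- exponential of the eliminated form.
  pf-pivot : ∀ v L S q b bs → (∀ x y → q x y ≡ q y x) → S v ≡ true → q b v ≡ true →
    All (λ b′ → q b b′ ≡ false) bs →
    pf (v ∷ L) S q (b ∷ bs) ≡ pf L S (eliminate q b v) bs
  pf-pivot v L S q b bs q-sym Sv bv b⊥bs rewrite Sv = coef-cong L S (begin
    e * (l * Q + ι (q b v) * P) + (e * m) * (l * P)
      ≈⟨ +-congʳ (*-congˡ (+-congˡ (*-congʳ (reflexive (≡.cong ι bv))))) ⟩
    e * (l * Q + 1# * P) + (e * m) * (l * P)
      ≈⟨ solve 5 (λ e l m P Q → e :* (l :* Q :+ con true :* P) :+ (e :* m) :* (l :* P)
           := (e :* (con true :+ l :* m)) :* (P :+ l :* Q) :+ (l :* l) :* (e :* m :* Q))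
           refl e l m P Q ⟩
    (e * (1# + l * m)) * (P + l * Q) + (l * l) * (e * m * Q)
      ≈⟨ +-congˡ (*-congʳ (lin² L (q b))) ⟩
    (e * (1# + l * m)) * (P + l * Q) + 0# * (e * m * Q)
      ≈⟨ trans (+-congˡ (zeroˡ _)) (+-identityʳ _) ⟩
    (e * (1# + l * m)) * (P + l * Q)
      ≈⟨ *-cong (trans (exp-+ L q (wedge (q b) (q v))) (*-congˡ (exp-wedge L (q b) (q v))))
                (eval bs b⊥bs) ⟨
    exp L (eliminate q b v) * linProduct L (eliminate q b v) bs ∎)
    where
    open Ring L
    open Solver
    e = exp L q
    l = lin L (q b)
    m = lin L (q v)
    P = proj₁ (linProduct (v ∷ L) q bs)
    Q = proj₂ (linProduct (v ∷ L) q bs)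

    -- P + l Q is the product over `bs` with l substituted for x_v; this substitution turns each
    -- form into the eliminated one.
    eval : ∀ bs → All (λ b′ → q b b′ ≡ false) bs → linProduct L (eliminate q b v) bs ≈
      proj₁ (linProduct (v ∷ L) q bs) + l * proj₂ (linProduct (v ∷ L) q bs)
    eval [] [] = sym (trans (+-congˡ (zeroʳ l)) (+-identityʳ 1#))
    eval (b′ ∷ bs) (b⊥b′ ∷ b⊥bs) = begin
      lin L (eliminate q b v b′) * linProduct L (eliminate q b v) bs
        ≈⟨ *-cong (trans (lin-cong L (λ {y} _ → row y))
                    (trans (lin-+ L _ _) (+-congˡ (lin-* L (q b′ v) (q b)))))
                  (eval bs b⊥bs) ⟩
      (l′ + c * l) * (P′ + l * Q′)
        ≈⟨ solve 5 (λ l′ c l P′ Q′ → (l′ :+ c :* l) :* (P′ :+ l :* Q′)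
             := (l′ :* P′ :+ l :* (l′ :* Q′ :+ c :* P′)) :+ (l :* l) :* (c :* Q′)) refl l′ c l P′ Q′ ⟩
      (l′ * P′ + l * (l′ * Q′ + c * P′)) + (l * l) * (c * Q′)
        ≈⟨ +-congˡ (trans (*-congʳ (lin² L (q b))) (zeroˡ _)) ⟩
      (l′ * P′ + l * (l′ * Q′ + c * P′)) + 0#
        ≈⟨ +-identityʳ _ ⟩
      l′ * P′ + l * (l′ * Q′ + c * P′) ∎
      where
      l′ = lin L (q b′)
      c = ι (q b′ v)
      P′ = proj₁ (linProduct (v ∷ L) q bs)
      Q′ = proj₂ (linProduct (v ∷ L) q bs)
      row : ∀ y → eliminate q b v b′ y ≡ q b′ y xor (q b′ v ∧ q b y)
      row y rewrite b⊥b′ | q-sym b′ v = ≡.refl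

-- Sums over 𝔽₂ and the dichotomy for Pfaffians

open ≡ using (_≢_; refl; sym; trans; cong; cong₂; subst; subst₂)
open import Data.Empty using (⊥-elim)
open import Data.List using (filter; filterᵇ; length; cartesianProduct)
open import Data.List.Membership.Propositional using (_∉_)
open import Data.List.Membership.Propositional.Properties
  using (∈-allFin; ∈-cartesianProduct⁺; ∈-filter⁺; ∈-filter⁻)
open import Data.List.Properties using (++-identityʳ)
open import Data.List.Relation.Binary.Permutation.Propositional.Properties using (∈-resp-↭; shift; ++⁺ʳ)
import Data.List.Relation.Binary.Permutation.Setoid.Properties as ↭ₛ
import Data.List.Relation.Unary.All.Properties as All
open import Data.List.Relation.Unary.AllPairs using (tail)
open import Data.List.Relation.Unary.Unique.Propositional using (Unique; []; _∷_)
open import Data.List.Relation.Unary.Unique.Propositional.Properties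
  using (Unique[x∷xs]⇒x∉xs; cartesianProduct⁺; allFin⁺; filter⁺)
open import Data.Sum as Sum using (_⊎_; inj₁; inj₂)
open import Function using (_∘_)
open import Relation.Binary.Definitions using (DecidableEquality; tri<; tri≈; tri>)
open import Relation.Nullary using (Dec; yes; no; does; ¬_)
open import Relation.Nullary.Decidable using (dec-true; dec-false)
open import Relation.Unary using (Decidable)

open Characteristic2.Solver 𝔽₂ refl using (solve; _:+_; _:*_; _:=_; con)

true≢false : true ≢ false
true≢false ()

xor≡false⇒≡ : ∀ {a b} → a xor b ≡ false → a ≡ b
xor≡false⇒≡ {true} {true} _ = refl
xor≡false⇒≡ {false} {false} _ = refl

≡⇒xor≡false : ∀ {a b} → a ≡ b → a xor b ≡ false
≡⇒xor≡false {a} refl = xor-same a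

⨁ : {A : Set} → List A → (A → Bool) → Bool
⨁ [] f = false
⨁ (x ∷ xs) f = f x xor ⨁ xs f

module _ {A : Set} where

  ⨁-cong : ∀ (xs : List A) {f g} → (∀ {x} → x ∈ xs → f x ≡ g x) → ⨁ xs f ≡ ⨁ xs g
  ⨁-cong [] eq = refl
  ⨁-cong (x ∷ xs) eq = cong₂ _xor_ (eq (here refl)) (⨁-cong xs (eq ∘ there))

  ⨁-0 : ∀ (xs : List A) {f} → (∀ {x} → x ∈ xs → f x ≡ false) → ⨁ xs f ≡ false
  ⨁-0 [] eq = refl
  ⨁-0 (x ∷ xs) eq = cong₂ _xor_ (eq (here refl)) (⨁-0 xs (eq ∘ there))

  ⨁-xor : ∀ (xs : List A) f g → ⨁ xs (λ x → f x xor g x) ≡ ⨁ xs f xor ⨁ xs g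
  ⨁-xor [] f g = refl
  ⨁-xor (x ∷ xs) f g = trans (cong ((f x xor g x) xor_) (⨁-xor xs f g))
    (solve 4 (λ a b c d → (a :+ b) :+ (c :+ d) := (a :+ c) :+ (b :+ d)) refl
      (f x) (g x) (⨁ xs f) (⨁ xs g))

  ⨁-∧ : ∀ (xs : List A) c f → ⨁ xs (λ x → c ∧ f x) ≡ c ∧ ⨁ xs f
  ⨁-∧ xs true f = refl
  ⨁-∧ xs false f = ⨁-0 xs (λ _ → refl)

  ⨁-↭ : ∀ {xs ys : List A} f → xs ↭ ys → ⨁ xs f ≡ ⨁ ys f
  ⨁-↭ f ↭.refl = refl
  ⨁-↭ f (↭.prep x σ) = cong (f x xor_) (⨁-↭ f σ)
  ⨁-↭ f (↭.swap {_} {ys} x y σ) = trans (cong (λ s → f x xor (f y xor s)) (⨁-↭ f σ))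
    (solve 3 (λ a b c → a :+ (b :+ c) := b :+ (a :+ c)) refl (f x) (f y) (⨁ ys f))
  ⨁-↭ f (↭.trans σ τ) = trans (⨁-↭ f σ) (⨁-↭ f τ)

-- Kernels of matrices over 𝔽₂ under symmetric elimination

module _ {V : Set} where

  Kernel : (V → V → Bool) → List V → (V → Bool) → Set
  Kernel q K f = ∀ {x} → x ∈ K → ⨁ K (λ y → q x y ∧ f y) ≡ false

  Nonsingular : (V → V → Bool) → List V → Set
  Nonsingular q K = ∀ f → Kernel q K f → ∀ {x} → x ∈ K → f x ≡ false

  Singular : (V → V → Bool) → List V → Set
  Singular q K = ∃ λ f → Kernel q K f × ∃ λ x → x ∈ K × f x ≡ true

  Kernel-↭ : ∀ {q K K′ f} → K ↭ K′ → Kernel q K f → Kernel q K′ f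
  Kernel-↭ {q} {f = f} σ ker {x} x∈K′ =
    trans (sym (⨁-↭ (λ y → q x y ∧ f y) σ)) (ker (∈-resp-↭ (↭-sym σ) x∈K′))

  Nonsingular-↭ : ∀ {q K K′} → K ↭ K′ → Nonsingular q K → Nonsingular q K′
  Nonsingular-↭ {q} σ ns f ker x∈K′ = ns f (Kernel-↭ {q} {f = f} (↭-sym σ) ker) (∈-resp-↭ (↭-sym σ) x∈K′)

  Singular-↭ : ∀ {q K K′} → K ↭ K′ → Singular q K → Singular q K′
  Singular-↭ {q} σ (f , ker , x , x∈K , fx) = f , Kernel-↭ {q} {f = f} σ ker , x , ∈-resp-↭ σ x∈K , fx

  Unique-↭ : ∀ {xs ys : List V} → xs ↭ ys → Unique xs → Unique ys
  Unique-↭ σ = ↭ₛ.Unique-resp-↭ (≡.setoid V) (↭⇒↭ₛ σ)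

  record Alternating (q : V → V → Bool) : Set where
    field
      symmetric : ∀ x y → q x y ≡ q y x
      diagonal : ∀ x → q x x ≡ false

  open Alternating

  eliminate-alternating : ∀ {q} b v → Alternating q → Alternating (eliminate q b v)
  eliminate-alternating {q} b v alt .symmetric x y = cong₂ _xor_ (alt .symmetric x y)
    (solve 4 (λ a b c d → a :* b :+ c :* d := d :* c :+ b :* a) refl
      (q b x) (q v y) (q v x) (q b y))
  eliminate-alternating {q} b v alt .diagonal x = cong₂ _xor_ (alt .diagonal x)
    (solve 2 (λ a b → a :* b :+ b :* a := con false) refl (q b x) (q v x))

  ⨁-eliminate : ∀ q b v x K (f : V → Bool) → ⨁ K (λ y → eliminate q b v x y ∧ f y) ≡
    ⨁ K (λ y → q x y ∧ f y) xor
    ((q b x ∧ ⨁ K (λ y → q v y ∧ f y)) xor (q v x ∧ ⨁ K (λ y → q b y ∧ f y)))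
  ⨁-eliminate q b v x K f = begin
    ⨁ K (λ y → eliminate q b v x y ∧ f y)
      ≡⟨ ⨁-cong K (λ {y} _ → solve 6 (λ a b c d e f →
           (a :+ (b :* c :+ d :* e)) :* f := a :* f :+ (b :* (c :* f) :+ d :* (e :* f)))
           refl (q x y) (q b x) (q v y) (q v x) (q b y) (f y)) ⟩
    ⨁ K (λ y → (q x y ∧ f y) xor ((q b x ∧ (q v y ∧ f y)) xor (q v x ∧ (q b y ∧ f y))))
      ≡⟨ ⨁-xor K (row x) (λ y → (q b x ∧ row v y) xor (q v x ∧ row b y)) ⟩
    ⨁ K (row x) xor ⨁ K (λ y → (q b x ∧ row v y) xor (q v x ∧ row b y))
      ≡⟨ cong (⨁ K (row x) xor_) (⨁-xor K (λ y → q b x ∧ row v y) (λ y → q v x ∧ row b y)) ⟩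
    ⨁ K (row x) xor (⨁ K (λ y → q b x ∧ row v y) xor ⨁ K (λ y → q v x ∧ row b y))
      ≡⟨ cong (⨁ K (row x) xor_) (cong₂ _xor_ (⨁-∧ K (q b x) (row v)) (⨁-∧ K (q v x) (row b))) ⟩
    ⨁ K (row x) xor ((q b x ∧ ⨁ K (row v)) xor (q v x ∧ ⨁ K (row b))) ∎
    where
    open ≡.≡-Reasoning
    row : V → V → Bool
    row x y = q x y ∧ f y

  module _ (_≟_ : DecidableEquality V) {q : V → V → Bool} (alt : Alternating q)
    {b v : V} (bv : q b v ≡ true) {K : List V} where

    private
      q′ = eliminate q b v

      vb : q v b ≡ true
      vb = trans (alt .symmetric v b) bv

      row : (V → Bool) → V → Bool
      row f x = ⨁ K (λ y → q x y ∧ f y)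

      row-b : ∀ f → (q b b ∧ f b) xor ((q b v ∧ f v) xor row f b) ≡ f v xor row f b
      row-b f rewrite alt .diagonal b | bv = refl

      row-v : ∀ f → (q v b ∧ f b) xor ((q v v ∧ f v) xor row f v) ≡ f b xor row f v
      row-v f rewrite alt .diagonal v | vb = refl

    -- As q(b,b) = q(v,v) = 0 and q(b,v) = 1, the rows of `b` and `v` express `f v` and `f b` by the
    -- values on `K`. Inserting these into the other rows gives the eliminated system.
    eliminate-Nonsingular : Nonsingular q′ K → Nonsingular q (b ∷ v ∷ K)
    eliminate-Nonsingular ns f ker = λ where
        (here refl) → trans fb (⨁-0 K (λ {y} y∈K → trans (cong (q v y ∧_) (f≡0 y∈K)) (∧-zeroʳ _)))
        (there (here refl)) → trans fv (⨁-0 K (λ {y} y∈K → trans (cong (q b y ∧_) (f≡0 y∈K)) (∧-zeroʳ _)))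
        (there (there x∈K)) → f≡0 x∈K
      where
      fv : f v ≡ row f b
      fv = xor≡false⇒≡ (trans (sym (row-b f)) (ker (here refl)))
      fb : f b ≡ row f v
      fb = xor≡false⇒≡ (trans (sym (row-v f)) (ker (there (here refl))))
      ker′ : Kernel q′ K f
      ker′ {x} x∈K = begin
        ⨁ K (λ y → q′ x y ∧ f y)
          ≡⟨ ⨁-eliminate q b v x K f ⟩
        row f x xor ((q b x ∧ row f v) xor (q v x ∧ row f b))
          ≡⟨ cong (row f x xor_) (cong₂ _xor_
               (cong₂ _∧_ (alt .symmetric b x) (sym fb)) (cong₂ _∧_ (alt .symmetric v x) (sym fv))) ⟩
        row f x xor ((q x b ∧ f b) xor (q x v ∧ f v))
          ≡⟨ solve 3 (λ a b c → a :+ (b :+ c) := b :+ (c :+ a)) refl (row f x) (q x b ∧ f b) (q x v ∧ f v) ⟩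
        (q x b ∧ f b) xor ((q x v ∧ f v) xor row f x)
          ≡⟨ ker (there (there x∈K)) ⟩
        false ∎
        where open ≡.≡-Reasoning
      f≡0 : ∀ {x} → x ∈ K → f x ≡ false
      f≡0 = ns f ker′

    -- Back substitution: `g` takes at `b` and `v` the values forced by the rows of `v` and `b`.
    -- Since neither lies in `K`, `g` agrees with `f` on `K`.
    eliminate-Singular : Unique (b ∷ v ∷ K) → Singular q′ K → Singular q (b ∷ v ∷ K)
    eliminate-Singular uniq@((b≢v ∷ _) ∷ uniq′) (f , ker′ , x , x∈K , fx) =
      g , ker , x , there (there x∈K) , trans (g≡f x∈K) fx
      where
      b∉K : b ∉ K
      b∉K b∈K = Unique[x∷xs]⇒x∉xs uniq (there b∈K)
      v∉K : v ∉ K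
      v∉K = Unique[x∷xs]⇒x∉xs uniq′
      g : V → Bool
      g x = if does (x ≟ b) then row f v else if does (x ≟ v) then row f b else f x
      gb : g b ≡ row f v
      gb rewrite dec-true (b ≟ b) refl = refl
      gv : g v ≡ row f b
      gv rewrite dec-false (v ≟ b) (b≢v ∘ sym) | dec-true (v ≟ v) refl = refl
      g≡f : ∀ {x} → x ∈ K → g x ≡ f x
      g≡f {x} x∈K
        rewrite dec-false (x ≟ b) (λ { refl → b∉K x∈K }) | dec-false (x ≟ v) (λ { refl → v∉K x∈K }) = refl
      row-g : ∀ x → row g x ≡ row f x
      row-g x = ⨁-cong K (λ {y} y∈K → cong (q x y ∧_) (g≡f y∈K))
      ker : Kernel q (b ∷ v ∷ K) g
      ker (here refl) = trans (row-b g) (trans (cong₂ _xor_ gv (row-g b)) (xor-same (row f b)))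
      ker (there (here refl)) = trans (row-v g) (trans (cong₂ _xor_ gb (row-g v)) (xor-same (row f v)))
      ker {x} (there (there x∈K)) = begin
        (q x b ∧ g b) xor ((q x v ∧ g v) xor row g x)
          ≡⟨ cong₂ _xor_ (cong₂ _∧_ (alt .symmetric x b) gb)
               (cong₂ _xor_ (cong₂ _∧_ (alt .symmetric x v) gv) (row-g x)) ⟩
        (q b x ∧ row f v) xor ((q v x ∧ row f b) xor row f x)
          ≡⟨ solve 3 (λ a b c → b :+ (c :+ a) := a :+ (b :+ c)) refl
               (row f x) (q b x ∧ row f v) (q v x ∧ row f b) ⟩
        row f x xor ((q b x ∧ row f v) xor (q v x ∧ row f b))
          ≡⟨ ⨁-eliminate q b v x K f ⟨
        ⨁ K (λ y → q′ x y ∧ f y)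
          ≡⟨ ker′ x∈K ⟩
        false ∎
        where open ≡.≡-Reasoning

  Dichotomy : Bool → (V → V → Bool) → List V → Set
  Dichotomy p q K = (p ≡ true × Nonsingular q K) ⊎ (p ≡ false × Singular q K)

  module _ (_≟_ : DecidableEquality V) where

    -- The vertices of `L` are treated in turn, while `bs` holds selected ones still waiting for a
    -- partner. An unselected vertex is skipped; one orthogonal to all of `bs` joins them; any other
    -- is eliminated together with a partner from `bs`.
    pf-dichotomy : ∀ L S q bs → Alternating q →
      (∀ {b b′} → b ∈ bs → b′ ∈ bs → q b b′ ≡ false) →
      Unique (bs ++ filterᵇ S L) →
      Dichotomy (pf L S q bs) q (bs ++ filterᵇ S L)
    pf-dichotomy [] S q [] alt iso uniq = inj₁ (refl , λ _ _ ())
    -- Vertices left without a partner carry a zero matrix, so the constant function 1 is a kernel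
    -- vector. The Pfaffian is 0 because linear forms in no variables are 0.
    pf-dichotomy [] S q (b ∷ bs) alt iso uniq = inj₂ (refl ,
      subst (Singular q) (sym (++-identityʳ (b ∷ bs)))
        ((λ _ → true) , (λ x∈ → ⨁-0 (b ∷ bs) (λ y∈ → cong (_∧ true) (iso x∈ y∈))) , b , here refl , refl))
    pf-dichotomy (v ∷ L) S q bs alt iso uniq = split (S v) refl
      where
      split : ∀ s → S v ≡ s → Dichotomy (pf (v ∷ L) S q bs) q (bs ++ filterᵇ S (v ∷ L))
      split false Sv = subst₂ (λ p vs → Dichotomy p q (bs ++ vs))
        (sym (pf-skip v L S q bs Sv)) (sym skip)
        (pf-dichotomy L S q bs alt iso (subst (λ vs → Unique (bs ++ vs)) skip uniq))
        where
        skip : filterᵇ S (v ∷ L) ≡ filterᵇ S L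
        skip rewrite Sv = refl
      split true Sv = subst (λ vs → Dichotomy (pf (v ∷ L) S q bs) q (bs ++ vs)) (sym keep)
          (pivot (findPivot bs))
        where
        rest = filterᵇ S L

        keep : filterᵇ S (v ∷ L) ≡ v ∷ rest
        keep rewrite Sv = refl

        uniq′ : Unique (bs ++ v ∷ rest)
        uniq′ = subst (λ vs → Unique (bs ++ vs)) keep uniq

        findPivot : ∀ bs → All (λ b → q b v ≡ false) bs ⊎
          ∃₂ λ b bs′ → bs ↭ b ∷ bs′ × q b v ≡ true
        findPivot [] = inj₁ []
        findPivot (b ∷ bs) with q b v in bv
        ... | true = inj₂ (b , bs , ↭.refl , bv)
        ... | false with findPivot bs
        ...   | inj₁ all = inj₁ (bv ∷ all)
        ...   | inj₂ (b′ , bs′ , σ , b′v) =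
          inj₂ (b′ , b ∷ bs′ , ↭.trans (↭.prep b σ) (↭.swap b b′ ↭.refl) , b′v)

        pivot : All (λ b → q b v ≡ false) bs ⊎ (∃₂ λ b bs′ → bs ↭ b ∷ bs′ × q b v ≡ true) →
          Dichotomy (pf (v ∷ L) S q bs) q (bs ++ v ∷ rest)
        pivot (inj₁ bs⊥v) = Sum.map
            (λ (eq , ns) → trans (pf-move v L S q bs Sv bs⊥v) eq , Nonsingular-↭ (↭-sym σ) ns)
            (λ (eq , sing) → trans (pf-move v L S q bs Sv bs⊥v) eq , Singular-↭ (↭-sym σ) sing)
            (pf-dichotomy L S q (v ∷ bs) alt iso′ (Unique-↭ σ uniq′))
          where
          σ : bs ++ v ∷ rest ↭ v ∷ bs ++ rest
          σ = shift v bs rest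
          iso′ : ∀ {b b′} → b ∈ v ∷ bs → b′ ∈ v ∷ bs → q b b′ ≡ false
          iso′ (here refl) (here refl) = alt .diagonal v
          iso′ (here refl) (there b′∈) = trans (alt .symmetric v _) (All.lookup bs⊥v b′∈)
          iso′ (there b∈) (here refl) = All.lookup bs⊥v b∈
          iso′ (there b∈) (there b′∈) = iso b∈ b′∈
        pivot (inj₂ (b , bs′ , τ , bv)) = Sum.map
            (λ (eq , ns) → trans pf≡ eq , Nonsingular-↭ (↭-sym σ) (eliminate-Nonsingular _≟_ alt bv ns))
            (λ (eq , sing) → trans pf≡ eq , Singular-↭ (↭-sym σ) (eliminate-Singular _≟_ alt bv uniq″ sing))
            (pf-dichotomy L S (eliminate q b v) bs′ (eliminate-alternating b v alt) iso′ (tail (tail uniq″)))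
          where
          σ : bs ++ v ∷ rest ↭ b ∷ v ∷ bs′ ++ rest
          σ = ↭.trans (++⁺ʳ (v ∷ rest) τ) (↭.prep b (shift v bs′ rest))
          uniq″ : Unique (b ∷ v ∷ bs′ ++ rest)
          uniq″ = Unique-↭ σ uniq′
          ∈bs : ∀ {x} → x ∈ b ∷ bs′ → x ∈ bs
          ∈bs = ∈-resp-↭ (↭-sym τ)
          b⊥ : ∀ {x} → x ∈ bs′ → q b x ≡ false
          b⊥ x∈ = iso (∈bs (here refl)) (∈bs (there x∈))
          -- `b` is orthogonal to `bs′`, so each term of the `wedge` has a vanishing factor.
          iso′ : ∀ {x y} → x ∈ bs′ → y ∈ bs′ → eliminate q b v x y ≡ false
          iso′ {x} {y} x∈ y∈ rewrite iso (∈bs (there x∈)) (∈bs (there y∈)) | b⊥ x∈ | b⊥ y∈ =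
            ∧-zeroʳ (q v x)
          pf≡ : pf (v ∷ L) S q bs ≡ pf L S (eliminate q b v) bs′
          pf≡ = trans (pf-↭ (v ∷ L) S q τ)
            (pf-pivot v L S q b bs′ (alt .symmetric) Sv bv (All.tabulate b⊥))

-- From matchings to coefficients

open import Defs
open import Data.Nat as ℕ using (ℕ; zero; suc; _%_)

odd : ℕ → Bool
odd zero = false
odd (suc n) = not (odd n)

module _ {A : Set} where

  ⨁-++ : ∀ (xs ys : List A) f → ⨁ (xs ++ ys) f ≡ ⨁ xs f xor ⨁ ys f
  ⨁-++ [] ys f = refl
  ⨁-++ (x ∷ xs) ys f = trans (cong (f x xor_) (⨁-++ xs ys f)) (sym (xor-assoc (f x) _ _))

  ⨁-map : ∀ {B : Set} (g : B → A) xs f → ⨁ (map g xs) f ≡ ⨁ xs (f ∘ g)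
  ⨁-map g [] f = refl
  ⨁-map g (x ∷ xs) f = cong (f (g x) xor_) (⨁-map g xs f)

  ⨁-filter : ∀ {P : A → Set} (P? : Decidable P) xs f →
    ⨁ (filter P? xs) f ≡ ⨁ xs (λ x → does (P? x) ∧ f x)
  ⨁-filter P? [] f = refl
  ⨁-filter P? (x ∷ xs) f with does (P? x)
  ... | true = cong (f x xor_) (⨁-filter P? xs f)
  ... | false = ⨁-filter P? xs f

  odd-length-filter : ∀ {P : A → Set} (P? : Decidable P) xs →
    odd (length (filter P? xs)) ≡ ⨁ xs (does ∘ P?)
  odd-length-filter P? [] = refl
  odd-length-filter P? (x ∷ xs) with does (P? x)
  ... | true = cong not (odd-length-filter P? xs)
  ... | false = odd-length-filter P? xs

module _ {A : Set} where

  ⨁-cartesianProduct : ∀ {B : Set} (xs : List A) (ys : List B) f →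
    ⨁ (cartesianProduct xs ys) f ≡ ⨁ xs (λ x → ⨁ ys (λ y → f (x , y)))
  ⨁-cartesianProduct [] ys f = refl
  ⨁-cartesianProduct (x ∷ xs) ys f = trans (⨁-++ (map (x ,_) ys) _ f)
    (cong₂ _xor_ (⨁-map (x ,_) ys f) (⨁-cartesianProduct xs ys f))

  ⨁-swap : ∀ {B : Set} (xs : List A) (ys : List B) (f : A → B → Bool) →
    ⨁ xs (λ x → ⨁ ys (f x)) ≡ ⨁ ys (λ y → ⨁ xs (λ x → f x y))
  ⨁-swap [] ys f = sym (⨁-0 ys (λ _ → refl))
  ⨁-swap (x ∷ xs) ys f = trans (cong (⨁ ys (f x) xor_) (⨁-swap xs ys f))
    (sym (⨁-xor ys (f x) (λ y → ⨁ xs (λ x → f x y))))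

  module _ (_≟_ : DecidableEquality A) where

    ⨁-δ : ∀ {xs} → Unique xs → ∀ {z} → z ∈ xs → (f : A → Bool) → ⨁ xs (λ x → does (x ≟ z) ∧ f x) ≡ f z
    ⨁-δ {x ∷ xs} uniq {z} (here refl) f rewrite dec-true (z ≟ z) refl =
      trans (cong (f z xor_) (⨁-0 xs (λ {y} y∈ → cong (_∧ f y)
        (dec-false (y ≟ z) (λ { refl → Unique[x∷xs]⇒x∉xs uniq y∈ }))))) (xor-identityʳ (f z))
    ⨁-δ {x ∷ xs} uniq@(_ ∷ uniq′) {z} (there z∈) f
      rewrite dec-false (x ≟ z) (λ { refl → Unique[x∷xs]⇒x∉xs uniq z∈ }) = ⨁-δ uniq′ z∈ f

All-sublists : ∀ {A : Set} {P : A → Set} {xs} → All P xs → All (All P) (sublists xs)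
All-sublists [] = [] ∷ []
All-sublists (px ∷ pxs) = All.++⁺ (All-sublists pxs) (All.map⁺ (All.map (px ∷_) (All-sublists pxs)))

module _ {V : Set} where

  coef-0 : ∀ (L : List V) S → let open Ring L in coef L S 0# ≡ false
  coef-0 [] S = refl
  coef-0 (v ∷ L) S with S v
  ... | true = coef-0 L S
  ... | false = coef-0 L S

  coef-1⁺ : ∀ (L : List V) S → let open Ring L in (∀ {v} → v ∈ L → S v ≡ false) → coef L S 1# ≡ true
  coef-1⁺ [] S _ = refl
  coef-1⁺ (v ∷ L) S eq rewrite eq (here refl) = coef-1⁺ L S (eq ∘ there)

  coef-1⁻ : ∀ (L : List V) S → let open Ring L in coef L S 1# ≡ true → ∀ {v} → v ∈ L → S v ≡ false
  coef-1⁻ (v ∷ L) S eq with S v in Sv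
  ... | true = λ _ → ⊥-elim (not-¬ eq (coef-0 L S))
  ... | false = λ { (here refl) → Sv ; (there v∈L) → coef-1⁻ L S eq v∈L }

  coef-selector-cong : ∀ (L : List V) {S S′} → (∀ {v} → v ∈ L → S v ≡ S′ v) → ∀ p →
    coef L S p ≡ coef L S′ p
  coef-selector-cong [] eq p = refl
  coef-selector-cong (v ∷ L) {S′ = S′} eq (a , b) rewrite eq (here refl) with S′ v
  ... | true = coef-selector-cong L (eq ∘ there) b
  ... | false = coef-selector-cong L (eq ∘ there) a

  module Matchings (_≟_ : DecidableEquality V) where

    δ : V → V → Bool
    δ u v = does (u ≟ v)

    -- Without repetitions in `L`, `lin L (δ u)` is the variable x_u. Multiplication by it kills the
    -- terms that contain x_u already and adds x_u to the others.
    coef-x : ∀ {L} → Unique L → ∀ S {u} → u ∈ L → ∀ p → let open Ring L in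
      coef L S (lin L (δ u) * p) ≡ S u ∧ coef L (λ v → S v ∧ not (δ u v)) p
    coef-x {v ∷ L} uniq S {u} (here refl) (a , b)
      rewrite dec-true (u ≟ u) refl with S u
    ... | true = begin
        coef L S (lin L (δ u) * b + 1# * a)
          ≡⟨ coef-cong L S (+-cong (trans′ (*-congʳ xᵤ≈0) (zeroˡ b)) (*-identityˡ a)) ⟩
        coef L S (0# + a)
          ≡⟨ coef-cong L S (+-identityˡ a) ⟩
        coef L S a
          ≡⟨ coef-selector-cong L (λ {y} y∈L → trans (sym (∧-identityʳ (S y)))
               (cong (λ d → S y ∧ not d) (sym (u≢ y∈L)))) a ⟩
        coef L (λ v → S v ∧ not (δ u v)) a ∎
      where
      open Ring L renaming (trans to trans′)
        using (_*_; _+_; 0#; 1#; +-cong; *-congʳ; zeroˡ; *-identityˡ; +-identityˡ; _≈_)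
      open ≡.≡-Reasoning
      u≢ : ∀ {y} → y ∈ L → δ u y ≡ false
      u≢ {y} y∈L = dec-false (u ≟ y) (λ { refl → Unique[x∷xs]⇒x∉xs uniq y∈L })
      xᵤ≈0 : lin L (δ u) ≈ 0#
      xᵤ≈0 = lin-0 L u≢
    ... | false = trans (coef-cong L S (trans′ (*-congʳ xᵤ≈0) (zeroˡ a))) (coef-0 L S)
      where
      open Ring L renaming (trans to trans′) using (0#; *-congʳ; zeroˡ; _≈_)
      xᵤ≈0 : lin L (δ u) ≈ 0#
      xᵤ≈0 = lin-0 L (λ {y} y∈L → dec-false (u ≟ y) (λ { refl → Unique[x∷xs]⇒x∉xs uniq y∈L }))
    coef-x {v ∷ L} uniq@(_ ∷ uniq′) S {u} (there u∈L) (a , b)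
      rewrite dec-false (u ≟ v) (λ { refl → Unique[x∷xs]⇒x∉xs uniq u∈L }) | ∧-identityʳ (S v) with S v
    ... | true = trans (coef-cong L S (trans′ (+-congˡ (zeroˡ a)) (+-identityʳ _))) (coef-x uniq′ S u∈L b)
      where open Ring L renaming (trans to trans′) using (+-congˡ; zeroˡ; +-identityʳ)
    ... | false = coef-x uniq′ S u∈L a

    module _ (L : List V) where
      open Ring L using (_*_; 1#) renaming (_+_ to _+Λ_; _≈_ to _≈Λ_)

      edgeTerm : V × V → ∣Λ L ∣
      edgeTerm (u , w) = lin L (δ u) * lin L (δ w)

      monomial : List (V × V) → ∣Λ L ∣
      monomial [] = 1#
      monomial (e ∷ M) = edgeTerm e * monomial M

      edgeProduct : List (V × V) → ∣Λ L ∣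
      edgeProduct [] = 1#
      edgeProduct (e ∷ E) = (1# +Λ edgeTerm e) * edgeProduct E

      -- Each edge contributes 1 or its term, so the expansion is indexed by the sublists of `E`.
      -- The factor `p` collects the terms already chosen.
      coef-edgeProduct : ∀ S E p →
        coef L S (p * edgeProduct E) ≡ ⨁ (sublists E) (λ M → coef L S (p * monomial M))
      coef-edgeProduct S [] p = sym (xor-identityʳ _)
      coef-edgeProduct S (e ∷ E) p = begin
        coef L S (p * ((1# +Λ m) * P))
          ≡⟨ coef-cong L S (Λsolve 3
               (λ p m P → p :*Λ ((con′ true :+Λ m) :*Λ P) :=Λ p :*Λ P :+Λ (p :*Λ m) :*Λ P)
               (Ring.refl L) p m P) ⟩
        coef L S (p * P +Λ (p * m) * P)
          ≡⟨ coef-+ L S (p * P) ((p * m) * P) ⟩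
        coef L S (p * P) xor coef L S ((p * m) * P)
          ≡⟨ cong₂ _xor_ (coef-edgeProduct S E p) (coef-edgeProduct S E (p * m)) ⟩
        ⨁ (sublists E) (λ M → coef L S (p * monomial M)) xor
        ⨁ (sublists E) (λ M → coef L S ((p * m) * monomial M))
          ≡⟨ cong (⨁ (sublists E) (λ M → coef L S (p * monomial M)) xor_)
               (trans (⨁-cong (sublists E) (λ {M} _ → coef-cong L S (Ring.*-assoc L p m (monomial M))))
                 (sym (⨁-map (e ∷_) (sublists E) (λ M → coef L S (p * monomial M))))) ⟩
        ⨁ (sublists E) (λ M → coef L S (p * monomial M)) xor
        ⨁ (map (e ∷_) (sublists E)) (λ M → coef L S (p * monomial M))
          ≡⟨ ⨁-++ (sublists E) _ _ ⟨
        ⨁ (sublists E ++ map (e ∷_) (sublists E)) (λ M → coef L S (p * monomial M)) ∎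
        where
        open ≡.≡-Reasoning
        open Ring.Solver L using ()
          renaming (solve to Λsolve; _:*_ to _:*Λ_; _:+_ to _:+Λ_; _:=_ to _:=Λ_; con to con′)
        m = edgeTerm e
        P = edgeProduct E

      edgeForm : List (V × V) → V → V → Bool
      edgeForm E x y = ⨁ E (λ (u , w) → wedge (δ u) (δ w) x y)

      exp-edgeForm : ∀ E → exp L (edgeForm E) ≈Λ edgeProduct E
      -- The zero form is the `wedge` of two zero functions.
      exp-edgeForm [] = R.trans (exp-wedge L (λ _ → false) (λ _ → false))
        (R.trans (R.+-congˡ (lin² L (λ _ → false))) (R.+-identityʳ 1#))
        where module R = Ring L
      exp-edgeForm ((u , w) ∷ E) = R.trans (exp-+ L (wedge (δ u) (δ w)) (edgeForm E))
        (R.*-cong (exp-wedge L (δ u) (δ w)) (exp-edgeForm E))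
        where module R = Ring L

      touches : V × V → V → Bool
      touches (u , w) v = δ u v ∨ δ w v

      -- Two uses of `coef-x`; since the ends differ, removing `u` does not unselect `w`.
      coef-edge : Unique L → (∀ v → v ∈ L) → ∀ S {u w} → u ≢ w → ∀ p →
        coef L S (edgeTerm (u , w) * p) ≡
        (S u ∧ S w) ∧ coef L (λ v → S v ∧ not (touches (u , w) v)) p
      coef-edge uniq complete S {u} {w} u≢w p = begin
        coef L S (edgeTerm (u , w) * p)
          ≡⟨ coef-cong L S (Ring.*-assoc L _ _ p) ⟩
        coef L S (lin L (δ u) * (lin L (δ w) * p))
          ≡⟨ coef-x uniq S (complete u) _ ⟩
        S u ∧ coef L (λ v → S v ∧ not (δ u v)) (lin L (δ w) * p)
          ≡⟨ cong (S u ∧_) (coef-x uniq _ (complete w) p) ⟩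
        S u ∧ ((S w ∧ not (δ u w)) ∧ coef L (λ v → (S v ∧ not (δ u v)) ∧ not (δ w v)) p)
          ≡⟨ cong (λ d → S u ∧ ((S w ∧ not d) ∧ coef L (λ v → (S v ∧ not (δ u v)) ∧ not (δ w v)) p))
               (dec-false (u ≟ w) u≢w) ⟩
        S u ∧ ((S w ∧ true) ∧ coef L (λ v → (S v ∧ not (δ u v)) ∧ not (δ w v)) p)
          ≡⟨ cong (λ s → S u ∧ (s ∧ coef L (λ v → (S v ∧ not (δ u v)) ∧ not (δ w v)) p)) (∧-identityʳ (S w)) ⟩
        S u ∧ (S w ∧ coef L (λ v → (S v ∧ not (δ u v)) ∧ not (δ w v)) p)
          ≡⟨ ∧-assoc (S u) (S w) _ ⟨
        (S u ∧ S w) ∧ coef L (λ v → (S v ∧ not (δ u v)) ∧ not (δ w v)) p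
          ≡⟨ cong ((S u ∧ S w) ∧_) (coef-selector-cong L (λ {v} _ → deMorgan (S v) (δ u v) (δ w v)) p) ⟩
        (S u ∧ S w) ∧ coef L (λ v → S v ∧ not (touches (u , w) v)) p ∎
        where
        open ≡.≡-Reasoning
        deMorgan : ∀ s a b → (s ∧ not a) ∧ not b ≡ s ∧ not (a ∨ b)
        deMorgan true true b = refl
        deMorgan true false b = refl
        deMorgan false a b = refl

open import Data.Nat using (_+_; _≤_; _<_; z≤n; s≤s; ∣_-_∣; _≡ᵇ_)
open import Data.Nat.Divisibility
open import Data.Nat.GCD using (gcd; gcd-greatest; gcd[m,n]∣m; gcd[m,n]∣n; gcd[m,n]≡0⇒m≡0)
open import Data.Nat.Properties
open import Data.Fin using (Fin; toℕ; fromℕ<)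
open import Data.Fin.Properties using (toℕ-injective; toℕ<n; toℕ-fromℕ<) renaming (_≟_ to _≟ᶠ_)
open import Data.Unit using (tt)
open import Function.Bundles using (_⇔_; mk⇔)

𝟙 : Bool → ℕ
𝟙 true = 1
𝟙 false = 0

n%2≡𝟙[odd] : ∀ n → n % 2 ≡ 𝟙 (odd n)
n%2≡𝟙[odd] zero = refl
n%2≡𝟙[odd] (suc zero) = refl
n%2≡𝟙[odd] (suc (suc n)) = trans (n%2≡𝟙[odd] n) (cong 𝟙 (sym (not-involutive (odd n))))

does-≡ : ∀ {P : Set} (P? : Dec P) b → (P → b ≡ true) → (b ≡ true → P) → does P? ≡ b
does-≡ (yes p) b f g = sym (f p)
does-≡ (no ¬p) true f g = ⊥-elim (¬p (g refl))
does-≡ (no ¬p) false f g = refl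

-- Bookkeeping at one vertex: `d` tells whether the first edge touches it, `s` whether it has to be
-- covered, and `k` is its degree in the remaining edges.
𝟙-remove⁺ : ∀ d s {k} → (d ≡ true → s ≡ true) → k ≡ 𝟙 (s ∧ not d) → 𝟙 d + k ≡ 𝟙 s
𝟙-remove⁺ true s d⇒s refl rewrite d⇒s refl = refl
𝟙-remove⁺ false s d⇒s refl = cong 𝟙 (∧-identityʳ s)

𝟙-remove⁻ : ∀ d s {k} → 𝟙 d + k ≡ 𝟙 s → (d ≡ true → s ≡ true) × k ≡ 𝟙 (s ∧ not d)
𝟙-remove⁻ true true eq = (λ _ → refl) , suc-injective eq
𝟙-remove⁻ false s eq = (λ ()) , trans eq (cong 𝟙 (sym (∧-identityʳ s)))

∧-true⁻ : ∀ {a b} → a ∧ b ≡ true → a ≡ true × b ≡ true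
∧-true⁻ {true} {true} _ = refl , refl

-- A sum rather than a disjunction: at most one of the two steps is possible, and the sum is visibly
-- symmetric with zero diagonal.
adjacent : ∀ {r c} → Vertex r c → Vertex r c → Bool
adjacent u v = does (step? u v) xor does (step? v u)

others : ∀ {r c} → Vertex r c → Vertex r c → Bool
others h v = not (does (v ≟ᵛ h))

-- The number of near-perfect matchings modulo 2 as a Pfaffian

module _ {r c : ℕ} where

  private
    L : List (Vertex r c)
    L = allVertices r c

  open Matchings (_≟ᵛ_ {r} {c})

  allVertices-unique : Unique L
  allVertices-unique = cartesianProduct⁺ (allFin⁺ r) (allFin⁺ c)

  ∈-allVertices : ∀ v → v ∈ L
  ∈-allVertices (i , j) = ∈-cartesianProduct⁺ (∈-allFin i) (∈-allFin j)

  Loopless : List (Edge r c) → Set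
  Loopless = All (λ (u , w) → u ≢ w)

  degree-∷ : ∀ e M v → degree (e ∷ M) v ≡ 𝟙 (touches L e v) + degree M v
  degree-∷ (u , w) M v with does (u ≟ᵛ v) ∨ does (w ≟ᵛ v)
  ... | true = refl
  ... | false = refl

  touched : ∀ {S : Vertex r c → Bool} {u w} → S u ≡ true → S w ≡ true →
    ∀ v → touches L (u , w) v ≡ true → S v ≡ true
  touched {u = u} {w} Su Sw v t with u ≟ᵛ v | w ≟ᵛ v
  ... | yes refl | _ = Su
  ... | no _ | yes refl = Sw

  -- Induction on the edges: by `coef-edge` the first edge joins two selected vertices, and the
  -- remaining edges have to cover exactly the selection without these two.
  coef-monomial⁺ : ∀ {M} → Loopless M → ∀ S → coef L S (monomial L M) ≡ true →
    ∀ v → degree M v ≡ 𝟙 (S v)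
  coef-monomial⁺ [] S eq v = cong 𝟙 (sym (coef-1⁻ L S eq (∈-allVertices v)))
  coef-monomial⁺ {e@(u , w) ∷ M} (u≢w ∷ loopless) S eq v
    with ∧-true⁻ {S u ∧ S w} (trans
           (sym (coef-edge L allVertices-unique ∈-allVertices S u≢w (monomial L M))) eq)
  ... | SuSw , eq′ with ∧-true⁻ {S u} SuSw
  ...   | Su , Sw = trans (degree-∷ e M v)
    (𝟙-remove⁺ (touches L e v) (S v) (touched {S} {u} {w} Su Sw v)
      (coef-monomial⁺ loopless (λ v → S v ∧ not (touches L e v)) eq′ v))

  coef-monomial⁻ : ∀ {M} → Loopless M → ∀ S → (∀ v → degree M v ≡ 𝟙 (S v)) →
    coef L S (monomial L M) ≡ true
  coef-monomial⁻ [] S deg = coef-1⁺ L S (λ {v} _ → 𝟙≡0 (deg v))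
    where
    𝟙≡0 : ∀ {b} → 0 ≡ 𝟙 b → b ≡ false
    𝟙≡0 {false} _ = refl
  coef-monomial⁻ {e@(u , w) ∷ M} (u≢w ∷ loopless) S deg =
    trans (coef-edge L allVertices-unique ∈-allVertices S u≢w (monomial L M))
      (cong₂ _∧_ (cong₂ _∧_ (proj₁ (removed u) tu) (proj₁ (removed w) tw))
        (coef-monomial⁻ loopless (λ v → S v ∧ not (touches L e v)) (λ v → proj₂ (removed v))))
    where
    removed : ∀ v → (touches L e v ≡ true → S v ≡ true) × degree M v ≡ 𝟙 (S v ∧ not (touches L e v))
    removed v = 𝟙-remove⁻ (touches L e v) (S v) (trans (sym (degree-∷ e M v)) (deg v))
    tu : touches L e u ≡ true
    tu rewrite dec-true (u ≟ᵛ u) refl = refl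
    tw : touches L e w ≡ true
    tw rewrite dec-true (w ≟ᵛ w) refl = ∨-zeroʳ _

  targetDegree-others : ∀ (h v : Vertex r c) → targetDegree h v ≡ 𝟙 (others h v)
  targetDegree-others h v with v ≟ᵛ h
  ... | yes _ = refl
  ... | no _ = refl

  isNearPerfectMissing-coef : ∀ h {M} → Loopless M →
    does (isNearPerfectMissing? h M) ≡ coef L (others h) (monomial L M)
  isNearPerfectMissing-coef h {M} loopless = does-≡ (isNearPerfectMissing? h M) _
    (λ perfect → coef-monomial⁻ loopless (others h)
      (λ v → trans (All.lookup perfect (∈-allVertices v)) (targetDegree-others h v)))
    (λ eq → All.tabulate
      (λ {v} _ → trans (coef-monomial⁺ loopless (others h) eq v) (sym (targetDegree-others h v))))

  gridEdges-loopless : Loopless (gridEdges r c)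
  gridEdges-loopless = All.map (λ step → step⇒≢ step)
    (All.all-filter (λ e → step? (proj₁ e) (proj₂ e)) (cartesianProduct L L))
    where
    step⇒≢ : {u v : Vertex r c} → Step u v → u ≢ v
    step⇒≢ (inj₁ (_ , eq)) refl = 1+n≢n (sym eq)
    step⇒≢ (inj₂ (_ , eq)) refl = 1+n≢n (sym eq)

  -- In the sum over all ordered pairs of vertices, the two terms of `wedge` pick out (x, y) and (y,
  -- x).
  edgeForm-gridEdges : ∀ x y → edgeForm L (gridEdges r c) x y ≡ adjacent x y
  edgeForm-gridEdges x y = begin
    ⨁ (gridEdges r c) (λ (u , w) → wedge (δ u) (δ w) x y)
      ≡⟨ ⨁-filter (λ e → step? (proj₁ e) (proj₂ e)) (cartesianProduct L L)
           (λ (u , w) → wedge (δ u) (δ w) x y) ⟩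
    ⨁ (cartesianProduct L L) (λ (u , w) → s u w ∧ wedge (δ u) (δ w) x y)
      ≡⟨ ⨁-cartesianProduct L L (λ (u , w) → s u w ∧ wedge (δ u) (δ w) x y) ⟩
    ⨁ L (λ u → ⨁ L (λ w → s u w ∧ wedge (δ u) (δ w) x y))
      ≡⟨ ⨁-cong L (λ {u} _ → inner u) ⟩
    ⨁ L (λ u → (δ u x ∧ s u y) xor (δ u y ∧ s u x))
      ≡⟨ ⨁-xor L (λ u → δ u x ∧ s u y) (λ u → δ u y ∧ s u x) ⟩
    ⨁ L (λ u → δ u x ∧ s u y) xor ⨁ L (λ u → δ u y ∧ s u x)
      ≡⟨ cong₂ _xor_ (pick x (λ u → s u y)) (pick y (λ u → s u x)) ⟩
    s x y xor s y x ∎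
    where
    open ≡.≡-Reasoning
    s : Vertex r c → Vertex r c → Bool
    s u w = does (step? u w)
    pick : ∀ z (f : Vertex r c → Bool) → ⨁ L (λ u → δ u z ∧ f u) ≡ f z
    pick z f = ⨁-δ _≟ᵛ_ allVertices-unique (∈-allVertices z) f
    inner : ∀ u → ⨁ L (λ w → s u w ∧ wedge (δ u) (δ w) x y) ≡ (δ u x ∧ s u y) xor (δ u y ∧ s u x)
    inner u = begin
      ⨁ L (λ w → s u w ∧ ((δ u x ∧ δ w y) xor (δ w x ∧ δ u y)))
        ≡⟨ ⨁-cong L (λ {w} _ → solve 5 (λ s a b c d → s :* (a :* b :+ c :* d)
             := a :* (b :* s) :+ d :* (c :* s)) refl (s u w) (δ u x) (δ w y) (δ w x) (δ u y)) ⟩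
      ⨁ L (λ w → (δ u x ∧ (δ w y ∧ s u w)) xor (δ u y ∧ (δ w x ∧ s u w)))
        ≡⟨ ⨁-xor L (λ w → δ u x ∧ (δ w y ∧ s u w)) (λ w → δ u y ∧ (δ w x ∧ s u w)) ⟩
      ⨁ L (λ w → δ u x ∧ (δ w y ∧ s u w)) xor ⨁ L (λ w → δ u y ∧ (δ w x ∧ s u w))
        ≡⟨ cong₂ _xor_ (⨁-∧ L (δ u x) (λ w → δ w y ∧ s u w)) (⨁-∧ L (δ u y) (λ w → δ w x ∧ s u w)) ⟩
      (δ u x ∧ ⨁ L (λ w → δ w y ∧ s u w)) xor (δ u y ∧ ⨁ L (λ w → δ w x ∧ s u w))
        ≡⟨ cong₂ (λ p q → (δ u x ∧ p) xor (δ u y ∧ q)) (pick y (s u)) (pick x (s u)) ⟩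
      (δ u x ∧ s u y) xor (δ u y ∧ s u x) ∎

  -- Modulo 2 the count is a sum of coefficients of monomials over all edge sets, thus a coefficient
  -- of the edge product, which is the exponential of the adjacency form.
  odd-a : ∀ h → odd (a r c h) ≡ pf L (others h) adjacent []
  odd-a h = begin
    odd (a r c h)
      ≡⟨ odd-length-filter (isNearPerfectMissing? h) (sublists E) ⟩
    ⨁ (sublists E) (λ M → does (isNearPerfectMissing? h M))
      ≡⟨ ⨁-cong (sublists E) (λ {M} M∈ → trans
           (isNearPerfectMissing-coef h (All.lookup (All-sublists gridEdges-loopless) M∈))
           (coef-cong L S (Λᴸ.sym (Λᴸ.*-identityˡ (monomial L M))))) ⟩
    ⨁ (sublists E) (λ M → coef L S (1# * monomial L M))
      ≡⟨ coef-edgeProduct L S E 1# ⟨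
    coef L S (1# * edgeProduct L E)
      ≡⟨ coef-cong L S (Λᴸ.trans (Λᴸ.*-comm 1# _) (Λᴸ.*-congʳ (Λᴸ.trans (Λᴸ.sym (exp-edgeForm L E))
           (exp-cong L (λ {x} {y} _ _ → edgeForm-gridEdges x y))))) ⟩
    coef L S (exp L adjacent * 1#) ∎
    where
    open ≡.≡-Reasoning
    module Λᴸ = Ring L
    open Λᴸ using (1#; _*_)
    E = gridEdges r c
    S = others h

  adjacent-alternating : Alternating (adjacent {r} {c})
  adjacent-alternating = record
    { symmetric = λ x y → xor-comm (does (step? x y)) (does (step? y x))
    ; diagonal = λ x → xor-same (does (step? x x))
    }

-- Functions on ℕ × ℕ with vanishing sums over neighbours

-- The sum of F over the neighbours of (i + 1, j + 1).
neighbours : (ℕ → ℕ → Bool) → ℕ → ℕ → Bool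
neighbours F i j =
  (F i (suc j) xor F (2 + i) (suc j)) xor (F (suc i) j xor F (suc i) (2 + j))

Harmonic : ℕ → ℕ → (ℕ → ℕ → Bool) → Set
Harmonic R C F = ∀ i j → suc i < R → suc j < C → neighbours F i j ≡ false

-- The grid is the interior of [0, R] × [0, C] for R = r + 1 and C = c + 1, its vertices having
-- 1-based coordinates.
record Dirichlet (R C : ℕ) (F : ℕ → ℕ → Bool) : Set where
  field
    top : ∀ j → j ≤ C → F 0 j ≡ false
    bottom : ∀ j → j ≤ C → F R j ≡ false
    left : ∀ i → i ≤ R → F i 0 ≡ false
    right : ∀ i → i ≤ R → F i C ≡ false
    harmonic : Harmonic R C F

open Dirichlet

odd-+ : ∀ m n → odd (m + n) ≡ odd m xor odd n
odd-+ zero n = refl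
odd-+ (suc m) n = trans (cong not (odd-+ m n)) (not-distribˡ-xor (odd m) (odd n))

xor-cancelʳ : ∀ {a b c d} → (a xor b) xor (c xor d) ≡ false → a ≡ c → b ≡ d
xor-cancelʳ {a} {b} {d = d} eq refl = begin
  b                                ≡⟨ xor-identityʳ b ⟨
  b xor false                      ≡⟨ cong (b xor_) eq ⟨
  b xor ((a xor b) xor (a xor d))  ≡⟨ solve 3 (λ a b d → b :+ ((a :+ b) :+ (a :+ d)) := d) refl a b d ⟩
  d                                ∎
  where open ≡.≡-Reasoning

transpose : ∀ {R C F} → Dirichlet R C F → Dirichlet C R (λ i j → F j i)
transpose D .top = D .left
transpose D .bottom = D .right
transpose D .left = D .top
transpose D .right = D .bottom
transpose {F = F} D .harmonic i j i<C j<R =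
  trans (xor-comm (F (suc j) i xor F (suc j) (2 + i)) _) (D .harmonic j i j<R i<C)

_⊕_ : (F G : ℕ → ℕ → Bool) → ℕ → ℕ → Bool
(F ⊕ G) i j = F i j xor G i j

⊕-harmonic : ∀ {R C F G} → Harmonic R C F → Harmonic R C G → Harmonic R C (F ⊕ G)
⊕-harmonic {F = F} {G} hF hG i j i<R j<C = trans
  (solve 8 (λ a b c d a′ b′ c′ d′ →
     ((a :+ a′) :+ (b :+ b′)) :+ ((c :+ c′) :+ (d :+ d′)) :=
     ((a :+ b) :+ (c :+ d)) :+ ((a′ :+ b′) :+ (c′ :+ d′))) refl
     (F i (suc j)) (F (2 + i) (suc j)) (F (suc i) j) (F (suc i) (2 + j))
     (G i (suc j)) (G (2 + i) (suc j)) (G (suc i) j) (G (suc i) (2 + j)))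
  (cong₂ _xor_ (hF i j i<R j<C) (hG i j i<R j<C))

⊕-Dirichlet : ∀ {R C F G} → Dirichlet R C F → Dirichlet R C G → Dirichlet R C (F ⊕ G)
⊕-Dirichlet D E .top j j≤C = cong₂ _xor_ (D .top j j≤C) (E .top j j≤C)
⊕-Dirichlet D E .bottom j j≤C = cong₂ _xor_ (D .bottom j j≤C) (E .bottom j j≤C)
⊕-Dirichlet D E .left i i≤R = cong₂ _xor_ (D .left i i≤R) (E .left i i≤R)
⊕-Dirichlet D E .right i i≤R = cong₂ _xor_ (D .right i i≤R) (E .right i i≤R)
⊕-Dirichlet {F = F} {G} D E .harmonic = ⊕-harmonic {F = F} {G} (D .harmonic) (E .harmonic)

oddOdd : ℕ → ℕ → Bool
oddOdd i j = odd i ∧ odd j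

-- Opposite neighbours differ by 2 in one coordinate, so their values are equal and cancel.
oddOdd-harmonic : ∀ {R C} → Harmonic R C oddOdd
oddOdd-harmonic i j _ _ rewrite not-involutive (odd i) | not-involutive (odd j) =
  solve 4 (λ a b c d → (a :* d :+ a :* d) :+ (c :* b :+ c :* b) := con false) refl
    (odd i) (odd j) (not (odd i)) (not (odd j))

oddOdd-Dirichlet : ∀ {R C} → odd R ≡ false → odd C ≡ false → Dirichlet R C oddOdd
oddOdd-Dirichlet R-even C-even .top j _ = refl
oddOdd-Dirichlet R-even C-even .bottom j _ = cong (_∧ odd j) R-even
oddOdd-Dirichlet R-even C-even .left i _ = ∧-zeroʳ (odd i)
oddOdd-Dirichlet R-even C-even .right i _ = trans (cong (odd i ∧_) C-even) (∧-zeroʳ (odd i))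
oddOdd-Dirichlet R-even C-even .harmonic = oddOdd-harmonic

-- Reflection in the diagonal of a square

module _ {R : ℕ} {F : ℕ → ℕ → Bool}
  (top₀ : ∀ j → j ≤ R → F 0 j ≡ false) (left₀ : ∀ i → i ≤ R → F i 0 ≡ false)
  (harm : Harmonic R R F) where

  private
    -- The equations at (a + 2, j + 1) and at its mirror image are added: three of the four
    -- neighbours are known to agree with their images, hence so does the fourth.
    symmetric-step : ∀ a j → 3 + a ≤ R → suc j < R →
      F (suc a) (suc j) ≡ F (suc j) (suc a) →
      F (2 + a) j ≡ F j (2 + a) →
      F (2 + a) (2 + j) ≡ F (2 + j) (2 + a) →
      F (3 + a) (suc j) ≡ F (suc j) (3 + a)
    symmetric-step a j a<R j<R h₁ h₂ h₃ = xor-cancelʳ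
      (trans rearrange (cong₂ _xor_ (harm (suc a) j a<R j<R) (harm j (suc a) j<R a<R)))
      (cong₂ _xor_ h₁ (cong₂ _xor_ h₂ h₃))
      where
      rearrange :
        ((F (suc a) (suc j) xor (F (2 + a) j xor F (2 + a) (2 + j))) xor F (3 + a) (suc j)) xor
        ((F (suc j) (suc a) xor (F j (2 + a) xor F (2 + j) (2 + a))) xor F (suc j) (3 + a)) ≡
        neighbours F (suc a) j xor neighbours F j (suc a)
      rearrange = solve 8 (λ p q r s p′ q′ r′ s′ →
        ((p :+ (q :+ r)) :+ s) :+ ((p′ :+ (q′ :+ r′)) :+ s′) :=
        ((p :+ s) :+ (q :+ r)) :+ ((q′ :+ r′) :+ (p′ :+ s′))) refl
        (F (suc a) (suc j)) (F (2 + a) j) (F (2 + a) (2 + j)) (F (3 + a) (suc j))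
        (F (suc j) (suc a)) (F j (2 + a)) (F (2 + j) (2 + a)) (F (suc j) (3 + a))

  -- Induction on the distance `d` from the diagonal and then on the column `j`, starting from the
  -- two zero sides. `symmetric-step` reaches distance d + 2 in column j + 1 from points at distance
  -- d and from distance d + 2 in column j.
  square-symmetric : ∀ d j → d + j ≤ R → F (d + j) j ≡ F j (d + j)
  square-symmetric zero j _ = refl
  square-symmetric (suc d) zero le = trans (left₀ _ le) (sym (top₀ _ le))
  -- The neighbours of the diagonal point (j + 1, j + 1) form two mirror pairs, so its equation
  -- carries the case d = 1 to the next column.
  square-symmetric (suc zero) (suc j) le =
    xor-cancelʳ (harm j j le le) (sym (square-symmetric 1 j (≤-trans (n≤1+n _) le)))
  square-symmetric (suc (suc d)) (suc j) le =
    moved eq (symmetric-step (d + j) j le′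
      (≤-trans (s≤s (s≤s (m≤n+m j d))) (≤-trans (n≤1+n _) le′))
      (moved (+-suc d j) (square-symmetric d (suc j) (≤-trans (m≤n+m _ 2) le)))
      (square-symmetric (suc (suc d)) j (≤-trans (n≤1+n _) le′))
      (moved eq′ (square-symmetric d (2 + j) (subst (_≤ R) (sym eq′) (≤-trans (n≤1+n _) le′)))))
    where
    moved : ∀ {m n k} → m ≡ n → F m k ≡ F k m → F n k ≡ F k n
    moved refl h = h
    eq : 3 + (d + j) ≡ 2 + (d + suc j)
    eq = cong (2 +_) (sym (+-suc d j))
    eq′ : d + (2 + j) ≡ 2 + (d + j)
    eq′ = trans (+-suc d (suc j)) (cong suc (+-suc d j))
    le′ : 3 + (d + j) ≤ R
    le′ = subst (_≤ R) (sym eq) le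

  -- The reflection takes the bottom side to the right side.
  square-fourth-side : (∀ j → j ≤ R → F R j ≡ false) → ∀ i → i ≤ R → F i R ≡ false
  square-fourth-side bottom₀ i i≤R = begin
    F i R              ≡⟨ cong (F i) eq ⟨
    F i (R ℕ.∸ i + i)  ≡⟨ square-symmetric (R ℕ.∸ i) i (≤-reflexive eq) ⟨
    F (R ℕ.∸ i + i) i  ≡⟨ cong (λ n → F n i) eq ⟩
    F R i              ≡⟨ bottom₀ i i≤R ⟩
    false              ∎
    where
    open ≡.≡-Reasoning
    eq : R ℕ.∸ i + i ≡ R
    eq = m∸n+n≡m i≤R

-- Zeros spread to the left: when columns k + 1 and k + 2 vanish, an equation centred in column k +
-- 1 leaves only the left neighbour. The ends of each column lie on the zero sides.
two-zero-columns : ∀ {R C F} → Harmonic R C F →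
  (∀ j → j ≤ C → F 0 j ≡ false) → (∀ j → j ≤ C → F R j ≡ false) →
  ∀ k → suc k ≤ C → (∀ i → i ≤ R → F i k ≡ false) → (∀ i → i ≤ R → F i (suc k) ≡ false) →
  ∀ i j → i ≤ R → j ≤ k → F i j ≡ false
two-zero-columns h top₀ bottom₀ zero k<C z z′ i .zero i≤R z≤n = z i i≤R
two-zero-columns {R} {C} {F} h top₀ bottom₀ (suc k) k<C z z′ i j i≤R j≤k with m≤n⇒m<n∨m≡n j≤k
... | inj₂ refl = z i i≤R
... | inj₁ (s≤s j≤k′) =
  two-zero-columns {R} {C} {F} h top₀ bottom₀ k (≤-trans (n≤1+n _) k<C) column z i j i≤R j≤k′
  where
  column : ∀ i → i ≤ R → F i k ≡ false
  column zero _ = top₀ k (≤-trans (m≤n+m k 2) k<C)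
  column (suc i) i<R with m≤n⇒m<n∨m≡n i<R
  ... | inj₂ refl = bottom₀ k (≤-trans (m≤n+m k 2) k<C)
  ... | inj₁ i+1<R = begin
    F (suc i) k
      ≡⟨ solve 1 (λ x → x := (con false :+ con false) :+ (x :+ con false)) refl (F (suc i) k) ⟩
    (false xor false) xor (F (suc i) k xor false)
      ≡⟨ cong₂ _xor_ (cong₂ _xor_ (z i (≤-trans (n≤1+n i) i<R)) (z (2 + i) i+1<R))
           (cong (F (suc i) k xor_) (z′ (suc i) i<R)) ⟨
    neighbours F i k
      ≡⟨ h i k i+1<R k<C ⟩
    false ∎
    where open ≡.≡-Reasoning

-- Cutting a square off a rectangle

shift-Dirichlet : ∀ {R C F} → Dirichlet R (R + C) F → Dirichlet R C (λ i j → F i (R + j))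
shift-Dirichlet {R} D .top j j≤C = D .top (R + j) (+-monoʳ-≤ R j≤C)
shift-Dirichlet {R} D .bottom j j≤C = D .bottom (R + j) (+-monoʳ-≤ R j≤C)
-- The new left side is the fourth side of the square that is cut off.
shift-Dirichlet {R} {C} {F} D .left i i≤R = trans (cong (F i) (+-identityʳ R))
  (square-fourth-side {F = F} (λ j j≤R → D .top j (≤-trans j≤R (m≤m+n R C))) (D .left)
    (λ i j i<R j<R → D .harmonic i j i<R (≤-trans j<R (m≤m+n R C)))
    (λ j j≤R → D .bottom j (≤-trans j≤R (m≤m+n R C))) i i≤R)
shift-Dirichlet D .right i i≤R = D .right i i≤R
shift-Dirichlet {R} {C} D .harmonic i j i<R j<C rewrite +-suc R (suc j) | +-suc R j =
  D .harmonic i (R + j) i<R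
    (subst (_< R + C) (+-suc R j) (+-monoʳ-< R j<C))

OddConstant : ℕ → ℕ → (ℕ → ℕ → Bool) → Set
OddConstant R C F = ∃ λ ε → ∀ i j → i ≤ R → j ≤ C → F i j ≡ ε ∧ oddOdd i j

-- As `R` is even, the shift by `R` preserves `oddOdd`. The difference of `F` and `ε ∧ oddOdd` thus
-- vanishes on columns R and R + 1, and `two-zero-columns` extends this to the square.
OddConstant-unshift : ∀ {R C F} → odd R ≡ false → 0 < C → Dirichlet R (R + C) F →
  OddConstant R C (λ i j → F i (R + j)) → OddConstant R (R + C) F
OddConstant-unshift {R} {C} {F} R-even C>0 D (ε , shifted) = ε , const
  where
  scaled : ℕ → ℕ → Bool
  scaled i j = ε ∧ oddOdd i j
  scaled-harmonic : ∀ ε → Harmonic R (R + C) (λ i j → ε ∧ oddOdd i j)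
  scaled-harmonic true = oddOdd-harmonic
  scaled-harmonic false i j _ _ = refl
  oddOdd-shift : ∀ i j → oddOdd i (R + j) ≡ oddOdd i j
  oddOdd-shift i j = cong (odd i ∧_) (trans (odd-+ R j) (cong (_xor odd j) R-even))
  agree : ∀ i j → i ≤ R → j ≤ C → F i (R + j) ≡ scaled i (R + j)
  agree i j i≤R j≤C = trans (shifted i j i≤R j≤C) (cong (ε ∧_) (sym (oddOdd-shift i j)))
  column : ∀ {k} j → R + j ≡ k → j ≤ C → ∀ i → i ≤ R → (F ⊕ scaled) i k ≡ false
  column j refl j≤C i i≤R = ≡⇒xor≡false (agree i j i≤R j≤C)
  const : ∀ i j → i ≤ R → j ≤ R + C → F i j ≡ scaled i j
  const i j i≤R j≤R+C with ≤-total j R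
  ... | inj₂ R≤j with m≤n⇒∃[o]m+o≡n R≤j
  ...   | o , refl = agree i o i≤R (+-cancelˡ-≤ R o C j≤R+C)
  const i j i≤R j≤R+C | inj₁ j≤R = xor≡false⇒≡
    (two-zero-columns (⊕-harmonic {F = F} {scaled} (D .harmonic) (scaled-harmonic ε))
      (λ j j≤ → cong₂ _xor_ (D .top j j≤) (∧-zeroʳ ε))
      (λ j j≤ → cong₂ _xor_ (D .bottom j j≤) (trans (cong (λ b → ε ∧ (b ∧ odd j)) R-even) (∧-zeroʳ ε)))
      R (subst (_≤ R + C) (+-comm R 1) (+-monoʳ-≤ R C>0))
      (column 0 (+-identityʳ R) z≤n) (column 1 (+-comm R 1) C>0)
      i j i≤R j≤R)

-- Euclid's algorithm on the side lengths: by square-fourth-side, an R × R square can be cut off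
-- an R × (R + C) rectangle.
mutual
  Dirichlet⇒OddConstant : ∀ n R C F → R + C ≤ n → 0 < R → 0 < C → odd R ≡ false → odd C ≡ false →
    (∀ {d} → d ∣ R → d ∣ C → d ∣ 2) → Dirichlet R C F → OddConstant R C F
  Dirichlet⇒OddConstant zero (suc R) C F () R>0 C>0 R-even C-even coprime D
  Dirichlet⇒OddConstant (suc n) R C F le R>0 C>0 R-even C-even coprime D with <-cmp R C
  ... | tri< R<C _ _ with m≤n⇒∃[o]m+o≡n (<⇒≤ R<C)
  ...   | k , refl = wide n R k F le R>0 R<C R-even C-even coprime D
  Dirichlet⇒OddConstant (suc n) R C F le R>0 C>0 R-even C-even coprime D
      | tri> _ _ C<R with m≤n⇒∃[o]m+o≡n (<⇒≤ C<R)
  ...   | k , refl with wide n C k (λ i j → F j i) (subst (_≤ suc n) (+-comm R C) le)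
                     C>0 C<R C-even R-even (λ d∣C d∣R → coprime d∣R d∣C) (transpose D)
  ...     | ε , const = ε , λ i j i≤R j≤C →
                     trans (const j i j≤C i≤R) (cong (ε ∧_) (∧-comm (odd j) (odd i)))
  Dirichlet⇒OddConstant (suc n) R C F le R>0 C>0 R-even C-even coprime D
      -- `R` divides both sides and hence 2; being even it is 2, and the square has a single
      -- interior point.
      | tri≈ _ refl _ = side (coprime ∣-refl ∣-refl) R-even R>0 D
    where
    side : ∀ {R} → R ∣ 2 → odd R ≡ false → 0 < R → Dirichlet R R F → OddConstant R R F
    side {zero} _ _ ()
    side {suc zero} _ ()
    side {suc (suc (suc R))} R∣2 _ _ with s≤s (s≤s ()) ← ∣⇒≤ R∣2
    side {2} _ _ _ D = F 1 1 , λ where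
      zero j _ j≤2 → trans (D .top j j≤2) (sym (∧-zeroʳ (F 1 1)))
      (suc zero) zero i≤2 _ → trans (D .left 1 i≤2) (sym (∧-zeroʳ (F 1 1)))
      (suc zero) (suc zero) _ _ → sym (∧-identityʳ (F 1 1))
      (suc zero) (suc (suc zero)) i≤2 _ → trans (D .right 1 i≤2) (sym (∧-zeroʳ (F 1 1)))
      (suc zero) (suc (suc (suc j))) _ (s≤s (s≤s ()))
      (suc (suc zero)) j _ j≤2 → trans (D .bottom j j≤2) (sym (∧-zeroʳ (F 1 1)))
      (suc (suc (suc i))) j (s≤s (s≤s ())) _

  -- The sum of the sides drops by `R`, and common divisors of `R` and `k` divide `R + k` too, so
  -- the hypotheses pass to the rest of the rectangle.
  wide : ∀ n R k F → R + (R + k) ≤ suc n → 0 < R → R < R + k →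
    odd R ≡ false → odd (R + k) ≡ false →
    (∀ {d} → d ∣ R → d ∣ R + k → d ∣ 2) → Dirichlet R (R + k) F → OddConstant R (R + k) F
  wide n R k F le R>0 R<R+k R-even R+k-even coprime D = OddConstant-unshift R-even k>0 D
    (Dirichlet⇒OddConstant n R k (λ i j → F i (R + j))
      (ℕ.s≤s⁻¹ (≤-trans (+-monoˡ-≤ (R + k) R>0) le)) R>0 k>0 R-even k-even
      (λ d∣R d∣k → coprime d∣R (∣m∣n⇒∣m+n d∣R d∣k)) (shift-Dirichlet D))
    where
    k>0 : 0 < k
    k>0 = +-cancelˡ-< R 0 k (subst (_< R + k) (sym (+-identityʳ R)) R<R+k)
    k-even : odd k ≡ false
    k-even = trans (sym (trans (odd-+ R k) (cong (_xor odd k) R-even))) R+k-even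

-- With [2g ∣ i + j] + [2g ∣ i − j] the light rays of a billiard in a g × g square are summed;
-- the two terms agree when g divides i or j.
billiard : ℕ → ℕ → ℕ → Bool
billiard g i j = ray (i + j) xor ray ∣ i - j ∣
  where
  ray : ℕ → Bool
  ray n = does (g + g ∣? n)

billiard-symmetric : ∀ g i j → billiard g i j ≡ billiard g j i
billiard-symmetric g i j = cong₂ (λ m n → does (g + g ∣? m) xor does (g + g ∣? n)) (+-comm i j) (∣-∣-comm i j)

-- The neighbours involve two coordinate sums and two differences, each occurring twice, so the rays
-- cancel.
billiard-harmonic : ∀ {R C} g → Harmonic R C (billiard g)
billiard-harmonic g i j _ _ rewrite +-suc i (suc j) | +-suc i j =
  solve 4 (λ a b c d → ((a :+ b) :+ (c :+ d)) :+ ((a :+ d) :+ (c :+ b)) := con false) refl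
    (does (g + g ∣? suc (i + j))) (does (g + g ∣? ∣ i - suc j ∣))
    (does (g + g ∣? 3 + (i + j))) (does (g + g ∣? ∣ suc i - j ∣))

-- R + j and R - j add up to 2R, a multiple of 2g, so 2g divides both or neither.
billiard-0 : ∀ {g R} → g ∣ R → ∀ j → billiard g R j ≡ false
billiard-0 {g} {R} g∣R j = ≡⇒xor≡false (does-≡ (g + g ∣? R + j) _
    (λ d → dec-true (g + g ∣? ∣ R - j ∣) (to d)) (λ d → from (does-true (g + g ∣? ∣ R - j ∣) d)))
  where
  does-true : ∀ {P : Set} (P? : Dec P) → does P? ≡ true → P
  does-true (yes p) _ = p
  2g∣2R : g + g ∣ R + R
  2g∣2R = double g∣R
    where
    double : ∀ {m} → g ∣ m → g + g ∣ m + m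
    double (divides q refl) = divides q (sym (*-distribˡ-+ q g g))
  to : g + g ∣ R + j → g + g ∣ ∣ R - j ∣
  to d with ≤-total R j
  ... | inj₁ R≤j with k , refl ← m≤n⇒∃[o]m+o≡n R≤j = subst (g + g ∣_) (sym (∣m-m+n∣≡n R k))
    (∣m+n∣m⇒∣n (subst (g + g ∣_) (sym (+-assoc R R k)) d) 2g∣2R)
  ... | inj₂ j≤R with k , refl ← m≤n⇒∃[o]m+o≡n j≤R =
    subst (g + g ∣_) (sym (trans (∣-∣-comm (j + k) j) (∣m-m+n∣≡n j k)))
    (∣m+n∣m⇒∣n (subst (g + g ∣_) eq 2g∣2R) d)
    where
    eq : (j + k) + (j + k) ≡ ((j + k) + j) + k
    eq = sym (+-assoc (j + k) j k)
  from : g + g ∣ ∣ R - j ∣ → g + g ∣ R + j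
  from d with ≤-total R j
  ... | inj₁ R≤j with k , refl ← m≤n⇒∃[o]m+o≡n R≤j = subst (g + g ∣_) (+-assoc R R k)
    (∣m∣n⇒∣m+n 2g∣2R (subst (g + g ∣_) (∣m-m+n∣≡n R k) d))
  ... | inj₂ j≤R with k , refl ← m≤n⇒∃[o]m+o≡n j≤R = ∣m+n∣m⇒∣n
    (subst (g + g ∣_) eq 2g∣2R) (subst (g + g ∣_) (trans (∣-∣-comm (j + k) j) (∣m-m+n∣≡n j k)) d)
    where
    eq : (j + k) + (j + k) ≡ k + ((j + k) + j)
    eq = trans (sym (+-assoc (j + k) j k)) (+-comm _ k)

billiard-Dirichlet : ∀ {R C} g → g ∣ R → g ∣ C → Dirichlet R C (billiard g)
billiard-Dirichlet g g∣R g∣C .top j _ = billiard-0 {g} {0} (g ∣0) j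
billiard-Dirichlet g g∣R g∣C .bottom j _ = billiard-0 g∣R j
billiard-Dirichlet g g∣R g∣C .left i _ = trans (billiard-symmetric g i 0) (billiard-0 {g} {0} (g ∣0) i)
billiard-Dirichlet {C = C} g g∣R g∣C .right i _ = trans (billiard-symmetric g i C) (billiard-0 g∣C i)
billiard-Dirichlet g g∣R g∣C .harmonic = billiard-harmonic g

module _ {g : ℕ} (2<g : 2 < g) where

  private
    -- As g is at least 3, the modulus 2g is at least 6.
    ray-small : ∀ n → .{{_ : ℕ.NonZero n}} → n < 6 → does (g + g ∣? n) ≡ false
    ray-small n n<6 = dec-false (g + g ∣? n)
      (λ d → <⇒≱ n<6 (≤-trans (+-mono-≤ 2<g 2<g) (∣⇒≤ d)))

  -- `oddOdd` is 1 at both (1, 1) and (1, 3), so the values there show that `billiard g` is neither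
  -- 0 nor equal to `oddOdd`.
  billiard-11 : billiard g 1 1 ≡ true
  billiard-11 = cong₂ _xor_ (ray-small 2 (s≤s (s≤s (s≤s z≤n)))) (dec-true (g + g ∣? 0) (_ ∣0))

  billiard-13 : billiard g 1 3 ≡ false
  billiard-13 = cong₂ _xor_
    (ray-small 4 (s≤s (s≤s (s≤s (s≤s (s≤s z≤n)))))) (ray-small 2 (s≤s (s≤s (s≤s z≤n))))

-- Kernel vectors of the grid

true⇒T : ∀ {b} → b ≡ true → T b
true⇒T refl = tt

T⇒true : ∀ {b} → T b → b ≡ true
T⇒true {true} _ = refl

≡ᵇ-true : ∀ m n → (m ≡ᵇ n) ≡ true → m ≡ n
≡ᵇ-true m n eq = ≡ᵇ⇒≡ m n (true⇒T eq)

≡ᵇ-refl : ∀ n → (n ≡ᵇ n) ≡ true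
≡ᵇ-refl n = T⇒true (≡⇒≡ᵇ n n refl)

≢⇒≡ᵇ-false : ∀ {m n} → m ≢ n → (m ≡ᵇ n) ≡ false
≢⇒≡ᵇ-false {m} {n} m≢n with m ≡ᵇ n in eq
... | true = ⊥-elim (m≢n (≡ᵇ-true m n eq))
... | false = refl

≡ᵇ-comm : ∀ m n → (m ≡ᵇ n) ≡ (n ≡ᵇ m)
≡ᵇ-comm zero zero = refl
≡ᵇ-comm zero (suc n) = refl
≡ᵇ-comm (suc m) zero = refl
≡ᵇ-comm (suc m) (suc n) = ≡ᵇ-comm m n

does-≟ᶠ : ∀ {n} (i j : Fin n) → does (i ≟ᶠ j) ≡ (toℕ j ≡ᵇ toℕ i)
does-≟ᶠ i j = does-≡ (i ≟ᶠ j) _ (λ { refl → ≡ᵇ-refl (toℕ i) })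
  (λ eq → toℕ-injective (sym (≡ᵇ-true (toℕ j) (toℕ i) eq)))

-- A right and a downward step are never both possible, so that the disjunction is a sum.
step-sum : ∀ i j i′ j′ →
  ((i′ ≡ᵇ i) ∧ (j′ ≡ᵇ suc j)) ∨ ((j′ ≡ᵇ j) ∧ (i′ ≡ᵇ suc i)) ≡
  ((i′ ≡ᵇ i) ∧ (j′ ≡ᵇ suc j)) xor ((i′ ≡ᵇ suc i) ∧ (j′ ≡ᵇ j))
step-sum i j i′ j′ with i′ ≡ᵇ i in eq
... | false = ∧-comm (j′ ≡ᵇ j) _
... | true rewrite ≡ᵇ-true i′ i eq | ≢⇒≡ᵇ-false {i} {suc i} (1+n≢n ∘ sym) | ∧-zeroʳ (j′ ≡ᵇ j) =
  trans (∨-identityʳ _) (sym (xor-identityʳ _))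

module _ {r c : ℕ} where

  private
    L : List (Vertex r c)
    L = allVertices r c

  located : ℕ → ℕ → Vertex r c → Bool
  located m n (i , j) = (suc (toℕ i) ≡ᵇ m) ∧ (suc (toℕ j) ≡ᵇ n)

  -- The extension by zero of a function on the vertices, with 1-based coordinates.
  extend : (Vertex r c → Bool) → ℕ → ℕ → Bool
  extend f m n = ⨁ L (λ v → located m n v ∧ f v)

  restrict : (ℕ → ℕ → Bool) → Vertex r c → Bool
  restrict F (i , j) = F (suc (toℕ i)) (suc (toℕ j))

  extend-restrict : ∀ f v → restrict (extend f) v ≡ f v
  extend-restrict f v@(i , j) = trans
    (⨁-cong L (λ {u} _ → cong (_∧ f u) (sym (located-≟ u))))
    (⨁-δ _≟ᵛ_ allVertices-unique (∈-allVertices v) f)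
    where
    located-≟ : ∀ u → does (u ≟ᵛ v) ≡ located (suc (toℕ i)) (suc (toℕ j)) u
    located-≟ u@(i′ , j′) = does-≡ (u ≟ᵛ v) _
      (λ { refl → cong₂ _∧_ (≡ᵇ-refl (toℕ i)) (≡ᵇ-refl (toℕ j)) })
      (λ eq → let eq₁ , eq₂ = ∧-true⁻ eq in cong₂ _,_
        (toℕ-injective (≡ᵇ-true (toℕ i′) (toℕ i) eq₁)) (toℕ-injective (≡ᵇ-true (toℕ j′) (toℕ j) eq₂)))

  extend-top : ∀ f n → extend f 0 n ≡ false
  extend-top f n = ⨁-0 L (λ _ → refl)

  extend-bottom : ∀ f n → extend f (suc r) n ≡ false
  extend-bottom f n = ⨁-0 L (λ {(i , j)} _ →
    cong (λ b → (b ∧ (suc (toℕ j) ≡ᵇ n)) ∧ f (i , j)) (≢⇒≡ᵇ-false (<⇒≢ (toℕ<n i))))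

  extend-left : ∀ f m → extend f m 0 ≡ false
  extend-left f m = ⨁-0 L (λ {v@(i , j)} _ → cong (_∧ f v) (∧-zeroʳ (suc (toℕ i) ≡ᵇ m)))

  extend-right : ∀ f m → extend f m (suc c) ≡ false
  extend-right f m = ⨁-0 L (λ {v@(i , j)} _ → cong (_∧ f v)
    (trans (cong ((suc (toℕ i) ≡ᵇ m) ∧_) (≢⇒≡ᵇ-false (<⇒≢ (toℕ<n j)))) (∧-zeroʳ _)))

  extend-Dirichlet : ∀ f → (∀ (i : Fin r) (j : Fin c) → neighbours (extend f) (toℕ i) (toℕ j) ≡ false) →
    Dirichlet (suc r) (suc c) (extend f)
  extend-Dirichlet f harm .top n _ = extend-top f n
  extend-Dirichlet f harm .bottom n _ = extend-bottom f n
  extend-Dirichlet f harm .left m _ = extend-left f m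
  extend-Dirichlet f harm .right m _ = extend-right f m
  extend-Dirichlet f harm .harmonic m n (s≤s m<r) (s≤s n<c) =
    subst₂ (λ m n → neighbours (extend f) m n ≡ false) (toℕ-fromℕ< m<r) (toℕ-fromℕ< n<c)
      (harm (fromℕ< m<r) (fromℕ< n<c))

  restrict-extend : ∀ {F} → Dirichlet (suc r) (suc c) F →
    ∀ m n → m ≤ suc r → n ≤ suc c → extend (restrict F) m n ≡ F m n
  restrict-extend {F} D zero n _ n≤ = trans (extend-top (restrict F) n) (sym (D .top n n≤))
  restrict-extend {F} D (suc m) zero m≤ _ =
    trans (extend-left (restrict F) (suc m)) (sym (D .left (suc m) m≤))
  restrict-extend {F} D (suc m) (suc n) (s≤s m≤r) (s≤s n≤c) with m≤n⇒m<n∨m≡n m≤r | m≤n⇒m<n∨m≡n n≤c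
  ... | inj₂ refl | _ = trans (extend-bottom (restrict F) (suc n)) (sym (D .bottom (suc n) (s≤s n≤c)))
  ... | inj₁ _ | inj₂ refl = trans (extend-right (restrict F) (suc m)) (sym (D .right (suc m) (s≤s m≤r)))
  ... | inj₁ m<r | inj₁ n<c =
    subst₂ (λ m n → extend (restrict F) (suc m) (suc n) ≡ F (suc m) (suc n))
      (toℕ-fromℕ< m<r) (toℕ-fromℕ< n<c) (extend-restrict (restrict F) (fromℕ< m<r , fromℕ< n<c))

  -- The vertex with 0-based coordinates (i, j) lies at (i + 1, j + 1), the centre of
  -- `neighbours _ i j`. Neighbours missing at the border of the grid contribute 0 through the
  -- extension.
  adjacent-sum : ∀ i j (f : Vertex r c → Bool) →
    ⨁ L (λ v → adjacent (i , j) v ∧ f v) ≡ neighbours (extend f) (toℕ i) (toℕ j)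
  adjacent-sum i j f = begin
    ⨁ L (λ v → adjacent (i , j) v ∧ f v)
      ≡⟨ ⨁-cong L (λ {v} _ → trans (cong (_∧ f v) (adjacent-located v))
           (solve 5 (λ p q s t x → ((p :+ q) :+ (s :+ t)) :* x :=
              (p :* x :+ q :* x) :+ (s :* x :+ t :* x)) refl
             (located m (suc n) v) (located (2 + m) (suc n) v)
             (located (suc m) n v) (located (suc m) (2 + n) v) (f v))) ⟩
    ⨁ L (λ v → (F m (suc n) v xor F (2 + m) (suc n) v) xor (F (suc m) n v xor F (suc m) (2 + n) v))
      ≡⟨ ⨁-xor L (λ v → F m (suc n) v xor F (2 + m) (suc n) v) (λ v → F (suc m) n v xor F (suc m) (2 + n) v) ⟩
    ⨁ L (λ v → F m (suc n) v xor F (2 + m) (suc n) v) xor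
    ⨁ L (λ v → F (suc m) n v xor F (suc m) (2 + n) v)
      ≡⟨ cong₂ _xor_ (⨁-xor L (F m (suc n)) (F (2 + m) (suc n)))
                     (⨁-xor L (F (suc m) n) (F (suc m) (2 + n))) ⟩
    neighbours (extend f) m n ∎
    where
    open ≡.≡-Reasoning
    m = toℕ i
    n = toℕ j
    F : ℕ → ℕ → Vertex r c → Bool
    F m n v = located m n v ∧ f v
    adjacent-located : ∀ v → adjacent (i , j) v ≡
      (located m (suc n) v xor located (2 + m) (suc n) v) xor
      (located (suc m) n v xor located (suc m) (2 + n) v)
    adjacent-located (i′ , j′)
      rewrite does-≟ᶠ i i′ | does-≟ᶠ j j′ | does-≟ᶠ i′ i | does-≟ᶠ j′ j = begin
      ((m′ ≡ᵇ m) ∧ (n′ ≡ᵇ suc n) ∨ (n′ ≡ᵇ n) ∧ (m′ ≡ᵇ suc m)) xor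
      ((m ≡ᵇ m′) ∧ (n ≡ᵇ suc n′) ∨ (n ≡ᵇ n′) ∧ (m ≡ᵇ suc m′))
        ≡⟨ cong₂ _xor_ (step-sum m n m′ n′) (step-sum m′ n′ m n) ⟩
      (((m′ ≡ᵇ m) ∧ (n′ ≡ᵇ suc n)) xor ((m′ ≡ᵇ suc m) ∧ (n′ ≡ᵇ n))) xor
      (((m ≡ᵇ m′) ∧ (n ≡ᵇ suc n′)) xor ((m ≡ᵇ suc m′) ∧ (n ≡ᵇ n′)))
        ≡⟨ cong ((((m′ ≡ᵇ m) ∧ (n′ ≡ᵇ suc n)) xor ((m′ ≡ᵇ suc m) ∧ (n′ ≡ᵇ n))) xor_)
             (cong₂ _xor_ (cong₂ _∧_ (≡ᵇ-comm m m′) (≡ᵇ-comm n (suc n′)))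
             (cong₂ _∧_ (≡ᵇ-comm m (suc m′)) (≡ᵇ-comm n n′))) ⟩
      (((m′ ≡ᵇ m) ∧ (n′ ≡ᵇ suc n)) xor ((m′ ≡ᵇ suc m) ∧ (n′ ≡ᵇ n))) xor
      (((m′ ≡ᵇ m) ∧ (suc n′ ≡ᵇ n)) xor ((suc m′ ≡ᵇ m) ∧ (n′ ≡ᵇ n)))
        ≡⟨ solve 4 (λ p q s t → (p :+ q) :+ (s :+ t) := (t :+ q) :+ (s :+ p)) refl
             ((m′ ≡ᵇ m) ∧ (n′ ≡ᵇ suc n)) ((m′ ≡ᵇ suc m) ∧ (n′ ≡ᵇ n))
             ((m′ ≡ᵇ m) ∧ (suc n′ ≡ᵇ n)) ((suc m′ ≡ᵇ m) ∧ (n′ ≡ᵇ n)) ⟩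
      (((suc m′ ≡ᵇ m) ∧ (n′ ≡ᵇ n)) xor ((m′ ≡ᵇ suc m) ∧ (n′ ≡ᵇ n))) xor
      (((m′ ≡ᵇ m) ∧ (suc n′ ≡ᵇ n)) xor ((m′ ≡ᵇ m) ∧ (n′ ≡ᵇ suc n))) ∎
      where
      m′ = toℕ i′
      n′ = toℕ j′

  restrict-harmonic : ∀ {F} → Dirichlet (suc r) (suc c) F → ∀ x →
    ⨁ L (λ y → adjacent x y ∧ restrict F y) ≡ false
  restrict-harmonic {F} D (i , j) = begin
    ⨁ L (λ y → adjacent (i , j) y ∧ restrict F y)
      ≡⟨ adjacent-sum i j (restrict F) ⟩
    neighbours (extend (restrict F)) m n
      ≡⟨ cong₂ _xor_
           (cong₂ _xor_ (same m (suc n) (≤-trans (n≤1+n m) m≤) n≤)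
                        (same (2 + m) (suc n) (s≤s (toℕ<n i)) n≤))
           (cong₂ _xor_ (same (suc m) n m≤ (≤-trans (n≤1+n n) n≤))
                        (same (suc m) (2 + n) m≤ (s≤s (toℕ<n j)))) ⟩
    neighbours F m n
      ≡⟨ D .harmonic m n (s≤s (toℕ<n i)) (s≤s (toℕ<n j)) ⟩
    false ∎
    where
    open ≡.≡-Reasoning
    m = toℕ i
    n = toℕ j
    m≤ : suc m ≤ suc r
    m≤ = ≤-trans (toℕ<n i) (n≤1+n r)
    n≤ : suc n ≤ suc c
    n≤ = ≤-trans (toℕ<n j) (n≤1+n c)
    same = restrict-extend D

  -- Deleting the vertex `h`

  module _ (h : Vertex r c) where

    private
      K : List (Vertex r c)
      K = filterᵇ (others h) L

    others-true : ∀ {v} → v ≢ h → others h v ≡ true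
    others-true {v} v≢h = cong not (dec-false (v ≟ᵛ h) v≢h)

    others-self : others h h ≡ false
    others-self = cong not (dec-true (h ≟ᵛ h) refl)

    ∈-others : ∀ {v} → v ≢ h → v ∈ K
    ∈-others {v} v≢h = ∈-filter⁺ (T? ∘ others h) (∈-allVertices v) (true⇒T (others-true v≢h))

    K-sum : ∀ x (f : Vertex r c → Bool) →
      ⨁ K (λ y → adjacent x y ∧ f y) ≡ ⨁ L (λ y → adjacent x y ∧ (others h y ∧ f y))
    K-sum x f = trans (⨁-filter (T? ∘ others h) L (λ y → adjacent x y ∧ f y))
      (⨁-cong L (λ {y} _ → solve 3 (λ a b c → a :* (b :* c) := b :* (a :* c)) refl
        (others h y) (adjacent x y) (f y)))

    -- As `F` vanishes at `h`, deleting `h` changes no sum over neighbours; `v` shows that the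
    -- vector is nonzero.
    Dirichlet⇒Singular : ∀ {F} → Dirichlet (suc r) (suc c) F → restrict F h ≡ false →
      ∀ v → restrict F v ≡ true → Singular adjacent K
    Dirichlet⇒Singular {F} D Fh v Fv =
      restrict F , kernel , v , ∈-others (λ { refl → true≢false (trans (sym Fv) Fh) }) , Fv
      where
      masked : ∀ y → others h y ∧ restrict F y ≡ restrict F y
      masked y with y ≟ᵛ h
      ... | yes refl = sym Fh
      ... | no _ = refl
      kernel : Kernel adjacent K (restrict F)
      kernel {x} _ = begin
        ⨁ K (λ y → adjacent x y ∧ restrict F y)
          ≡⟨ K-sum x (restrict F) ⟩
        ⨁ L (λ y → adjacent x y ∧ (others h y ∧ restrict F y))
          ≡⟨ ⨁-cong L (λ {y} _ → cong (adjacent x y ∧_) (masked y)) ⟩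
        ⨁ L (λ y → adjacent x y ∧ restrict F y)
          ≡⟨ restrict-harmonic D x ⟩
        false ∎
        where open ≡.≡-Reasoning

    module _ (r-odd : odd r ≡ true) (c-odd : odd c ≡ true) (h-odd : restrict oddOdd h ≡ true) where

      private
        φ : Vertex r c → Bool
        φ = restrict oddOdd

        φ-harmonic : ∀ x → ⨁ L (λ y → adjacent x y ∧ φ y) ≡ false
        φ-harmonic = restrict-harmonic (oddOdd-Dirichlet (cong not r-odd) (cong not c-odd))

      -- Pairing with oddOdd, which is in the kernel and does not vanish at h.
      harmonic-at-h : ∀ (f : Vertex r c → Bool) →
        (∀ x → x ≢ h → ⨁ L (λ y → adjacent x y ∧ f y) ≡ false) →
        ⨁ L (λ y → adjacent h y ∧ f y) ≡ false
      harmonic-at-h f harm = begin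
        row h
          ≡⟨ cong (_∧ row h) h-odd ⟨
        φ h ∧ row h
          ≡⟨ ⨁-δ _≟ᵛ_ allVertices-unique (∈-allVertices h) (λ x → φ x ∧ row x) ⟨
        ⨁ L (λ x → does (x ≟ᵛ h) ∧ (φ x ∧ row x))
          ≡⟨ ⨁-cong L (λ {x} _ → concentrated x) ⟩
        ⨁ L (λ x → φ x ∧ row x)
          ≡⟨ ⨁-cong L (λ {x} _ → ⨁-∧ L (φ x) (λ y → adjacent x y ∧ f y)) ⟨
        ⨁ L (λ x → ⨁ L (λ y → φ x ∧ (adjacent x y ∧ f y)))
          ≡⟨ ⨁-swap L L (λ x y → φ x ∧ (adjacent x y ∧ f y)) ⟩
        ⨁ L (λ y → ⨁ L (λ x → φ x ∧ (adjacent x y ∧ f y)))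
          ≡⟨ ⨁-0 L (λ {y} _ → column y) ⟩
        false ∎
        where
        open ≡.≡-Reasoning
        row : Vertex r c → Bool
        row x = ⨁ L (λ y → adjacent x y ∧ f y)
        concentrated : ∀ x → does (x ≟ᵛ h) ∧ (φ x ∧ row x) ≡ φ x ∧ row x
        concentrated x with x ≟ᵛ h
        ... | yes _ = refl
        ... | no x≢h = sym (trans (cong (φ x ∧_) (harm x x≢h)) (∧-zeroʳ (φ x)))
        -- By symmetry of `adjacent` each column sum is a multiple of a sum of `φ` over neighbours.
        column : ∀ y → ⨁ L (λ x → φ x ∧ (adjacent x y ∧ f y)) ≡ false
        column y = begin
          ⨁ L (λ x → φ x ∧ (adjacent x y ∧ f y))
            ≡⟨ ⨁-cong L (λ {x} _ → trans
                 (cong (λ a → φ x ∧ (a ∧ f y)) (Alternating.symmetric adjacent-alternating x y))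
                 (solve 3 (λ a b c → a :* (b :* c) := c :* (b :* a)) refl (φ x) (adjacent y x) (f y))) ⟩
          ⨁ L (λ x → f y ∧ (adjacent y x ∧ φ x))
            ≡⟨ ⨁-∧ L (f y) (λ x → adjacent y x ∧ φ x) ⟩
          f y ∧ ⨁ L (λ x → adjacent y x ∧ φ x)
            ≡⟨ trans (cong (f y ∧_) (φ-harmonic y)) (∧-zeroʳ (f y)) ⟩
          false ∎

      -- `g` is `f` set to 0 at `h`. By `harmonic-at-h` it solves the equations at every vertex, so
      -- it is a multiple of `oddOdd`; its value 0 at `h`, where `oddOdd` is 1, makes the factor 0.
      coprime⇒Nonsingular : (∀ {d} → d ∣ suc r → d ∣ suc c → d ∣ 2) → Nonsingular adjacent K
      coprime⇒Nonsingular coprime f kernel {x} x∈K = begin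
        f x                      ≡⟨ cong (_∧ f x) (others-K x∈K) ⟨
        g x                      ≡⟨ extend-restrict g x ⟨
        restrict (extend g) x    ≡⟨ g≡ x ⟩
        ε ∧ φ x                  ≡⟨ cong (_∧ φ x) ε≡false ⟩
        false                    ∎
        where
        open ≡.≡-Reasoning
        others-K : ∀ {x} → x ∈ K → others h x ≡ true
        others-K x∈K = T⇒true (proj₂ (∈-filter⁻ (T? ∘ others h) {xs = L} x∈K))
        g : Vertex r c → Bool
        g y = others h y ∧ f y
        g-harmonic-off-h : ∀ x → x ≢ h → ⨁ L (λ y → adjacent x y ∧ g y) ≡ false
        g-harmonic-off-h x x≢h = trans (sym (K-sum x f)) (kernel (∈-others x≢h))
        g-harmonic : ∀ x → ⨁ L (λ y → adjacent x y ∧ g y) ≡ false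
        g-harmonic x with x ≟ᵛ h
        ... | yes refl = harmonic-at-h g g-harmonic-off-h
        ... | no x≢h = g-harmonic-off-h x x≢h
        constant : OddConstant (suc r) (suc c) (extend g)
        constant = Dirichlet⇒OddConstant _ (suc r) (suc c) (extend g) ≤-refl (s≤s z≤n) (s≤s z≤n)
          (cong not r-odd) (cong not c-odd) coprime
          (extend-Dirichlet g (λ i j → trans (sym (adjacent-sum i j g)) (g-harmonic (i , j))))
        ε = proj₁ constant
        g≡ : ∀ v → restrict (extend g) v ≡ ε ∧ φ v
        g≡ (i , j) = proj₂ constant _ _
          (≤-trans (toℕ<n i) (n≤1+n r)) (≤-trans (toℕ<n j) (n≤1+n c))
        ε≡false : ε ≡ false
        ε≡false = begin
          ε                      ≡⟨ ∧-identityʳ ε ⟨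
          ε ∧ true               ≡⟨ cong (ε ∧_) h-odd ⟨
          ε ∧ φ h                ≡⟨ g≡ h ⟨
          restrict (extend g) h  ≡⟨ extend-restrict g h ⟩
          others h h ∧ f h       ≡⟨ cong (_∧ f h) others-self ⟩
          false                  ∎

    a-dichotomy : Dichotomy (odd (a r c h)) adjacent K
    a-dichotomy = subst (λ p → Dichotomy p adjacent K) (sym (odd-a h))
      (pf-dichotomy _≟ᵛ_ L (others h) adjacent [] adjacent-alternating (λ ())
        (filter⁺ (T? ∘ others h) allVertices-unique))

-- Parities, nonzero solutions vanishing at `h`, and the conclusion

¬Nonsingular×Singular : ∀ {V : Set} {q : V → V → Bool} {K} → Nonsingular q K → ¬ Singular q K
¬Nonsingular×Singular nonsingular (f , kernel , x , x∈K , fx) =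
  true≢false (trans (sym fx) (nonsingular f kernel x∈K))

n%2≡1⇒odd : ∀ n → n % 2 ≡ 1 → odd n ≡ true
n%2≡1⇒odd n eq with odd n | trans (sym (n%2≡𝟙[odd] n)) eq
... | true | _ = refl

odd⇒n%2≡1 : ∀ n → odd n ≡ true → n % 2 ≡ 1
odd⇒n%2≡1 n eq = trans (n%2≡𝟙[odd] n) (cong 𝟙 eq)

even⇒2∣n : ∀ n → odd n ≡ false → 2 ∣ n
even⇒2∣n n eq = m%n≡0⇒n∣m n 2 (trans (n%2≡𝟙[odd] n) (cong 𝟙 eq))

1-or-3-mod-4 : ∀ n → odd n ≡ true → n % 4 ≡ 1 ⊎ 4 ∣ suc n
1-or-3-mod-4 1 _ = inj₁ refl
1-or-3-mod-4 3 _ = inj₂ ∣-refl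
1-or-3-mod-4 (suc (suc (suc (suc n)))) n-odd
  with 1-or-3-mod-4 n (not-injective (not-injective (not-injective (not-injective n-odd))))
... | inj₁ eq = inj₁ eq
... | inj₂ 4∣ = inj₂ (∣m∣n⇒∣m+n ∣-refl 4∣)

KernelVectorVanishingAt : ∀ {r c} → Vertex r c → Set
KernelVectorVanishingAt {r} {c} h = ∃ λ F →
  Dirichlet (suc r) (suc c) F × restrict F h ≡ false × ∃ λ (v : Vertex r c) → restrict F v ≡ true

module _ {r c : ℕ} (r-odd : odd r ≡ true) (c-odd : odd c ≡ true) where

  private
    at : ∀ {m n} → m < r → n < c → ∀ F → F (suc m) (suc n) ≡ true → ∃ λ (v : Vertex r c) → restrict F v ≡ true
    at m<r n<c F eq = (fromℕ< m<r , fromℕ< n<c) ,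
      trans (cong₂ (λ m n → F (suc m) (suc n)) (toℕ-fromℕ< m<r) (toℕ-fromℕ< n<c)) eq

    odd⇒>0 : ∀ {n} → odd n ≡ true → 0 < n
    odd⇒>0 {suc n} _ = s≤s z≤n

    oddOdd-D : Dirichlet (suc r) (suc c) oddOdd
    oddOdd-D = oddOdd-Dirichlet (cong not r-odd) (cong not c-odd)

  kernel-vector-notOdd : ∀ (h : Vertex r c) → restrict oddOdd h ≡ false →
    KernelVectorVanishingAt h
  kernel-vector-notOdd h h-notOdd =
    oddOdd , oddOdd-D , h-notOdd , at (odd⇒>0 r-odd) (odd⇒>0 c-odd) oddOdd refl

  -- One of `oddOdd`, `billiard g` and their sum is 0 at `h`. The first two are nonzero at (1, 1),
  -- the sum at (1, 3).
  kernel-vector-gcd : ∀ (h : Vertex r c) g → g ∣ suc r → g ∣ suc c → 2 < g →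
    KernelVectorVanishingAt h
  kernel-vector-gcd h g g∣r+1 g∣c+1 2<g with restrict (billiard g) h in eq | restrict oddOdd h in eq′
  ... | _ | false = kernel-vector-notOdd h eq′
  ... | false | true = billiard g , billiard-Dirichlet g g∣r+1 g∣c+1 , eq ,
    at (odd⇒>0 r-odd) (odd⇒>0 c-odd) (billiard g) (billiard-11 2<g)
  ... | true | true = billiard g ⊕ oddOdd ,
    ⊕-Dirichlet (billiard-Dirichlet g g∣r+1 g∣c+1) oddOdd-D , cong₂ _xor_ eq eq′ ,
    at (odd⇒>0 r-odd) 2<c (billiard g ⊕ oddOdd) (cong (_xor true) (billiard-13 2<g))
    where
    2<c : 2 < c
    -- `g` exceeds 2 and divides c + 1, so c is at least 2; being odd it is at least 3, and (1, 3)
    -- lies in the grid.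
    2<c = ≤∧≢⇒< (ℕ.s≤s⁻¹ (≤-trans 2<g (∣⇒≤ g∣c+1)))
      (λ { refl → true≢false (sym c-odd) })

theorem5 : (r c : ℕ) → r % 2 ≡ 1 → c % 2 ≡ 1 → (h : Vertex r c) → White h →
    (a r c h % 2 ≡ 1 ⇔ ((r % 4 ≡ 1 ⊎ c % 4 ≡ 1) × gcd (r + 1) (c + 1) ≡ 2 × OddVertex h))
theorem5 r c r%2≡1 c%2≡1 h@(i , j) _ rewrite +-comm r 1 | +-comm c 1 = mk⇔ to from
  where
  g = gcd (suc r) (suc c)

  r-odd : odd r ≡ true
  r-odd = n%2≡1⇒odd r r%2≡1

  c-odd : odd c ≡ true
  c-odd = n%2≡1⇒odd c c%2≡1

  no-kernel-vector : a r c h % 2 ≡ 1 → ¬ KernelVectorVanishingAt h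
  no-kernel-vector a-odd (F , D , Fh , v , Fv) = refute (a-dichotomy h)
    where
    refute : ¬ Dichotomy (odd (a r c h)) adjacent (filterᵇ (others h) (allVertices r c))
    refute (inj₁ (_ , nonsingular)) = ¬Nonsingular×Singular nonsingular (Dirichlet⇒Singular h D Fh v Fv)
    refute (inj₂ (a-even , _)) = true≢false (trans (sym (n%2≡1⇒odd (a r c h) a-odd)) a-even)

  gcd-small : ¬ 2 < g → g ≡ 2
  gcd-small 2≮g = ≤-antisym (≮⇒≥ 2≮g) (∣⇒≤ {{ℕ.≢-nonZero (λ eq → 1+n≢0 (gcd[m,n]≡0⇒m≡0 {suc r} {suc c} eq))}}
    (gcd-greatest (even⇒2∣n (suc r) (cong not r-odd)) (even⇒2∣n (suc c) (cong not c-odd))))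

  -- If `r` and `c` were both 3 modulo 4, then 4 would divide `g`.
  mod-4 : g ≡ 2 → r % 4 ≡ 1 ⊎ c % 4 ≡ 1
  mod-4 g≡2 with 1-or-3-mod-4 r r-odd | 1-or-3-mod-4 c c-odd
  ... | inj₁ r%4≡1 | _ = inj₁ r%4≡1
  ... | inj₂ _ | inj₁ c%4≡1 = inj₂ c%4≡1
  ... | inj₂ 4∣r+1 | inj₂ 4∣c+1 with s≤s (s≤s ()) ← ∣⇒≤ (subst (4 ∣_) g≡2 (gcd-greatest 4∣r+1 4∣c+1))

  to : a r c h % 2 ≡ 1 → (r % 4 ≡ 1 ⊎ c % 4 ≡ 1) × g ≡ 2 × OddVertex h
  to a-odd = mod-4 g≡2 , g≡2 , oddVertex
    where
    g≡2 : g ≡ 2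
    g≡2 = gcd-small (λ 2<g → no-kernel-vector a-odd
      (kernel-vector-gcd r-odd c-odd h g (gcd[m,n]∣m (suc r) (suc c)) (gcd[m,n]∣n (suc r) (suc c)) 2<g))
    oddVertex : OddVertex h
    oddVertex with restrict oddOdd h in eq
    ... | false = ⊥-elim (no-kernel-vector a-odd (kernel-vector-notOdd r-odd c-odd h eq))
    ... | true with ∧-true⁻ {odd (suc (toℕ i))} eq
    ...   | i-odd , j-odd = odd⇒n%2≡1 (suc (toℕ i)) i-odd , odd⇒n%2≡1 (suc (toℕ j)) j-odd

  from : (r % 4 ≡ 1 ⊎ c % 4 ≡ 1) × g ≡ 2 × OddVertex h → a r c h % 2 ≡ 1
  from (_ , g≡2 , i-odd , j-odd) = odd⇒n%2≡1 (a r c h) (conclude (a-dichotomy h))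
    where
    conclude : Dichotomy (odd (a r c h)) adjacent (filterᵇ (others h) (allVertices r c)) →
      odd (a r c h) ≡ true
    conclude (inj₁ (a-odd , _)) = a-odd
    conclude (inj₂ (_ , singular)) = ⊥-elim (¬Nonsingular×Singular
      (coprime⇒Nonsingular h r-odd c-odd
        (cong₂ _∧_ (n%2≡1⇒odd (suc (toℕ i)) i-odd) (n%2≡1⇒odd (suc (toℕ j)) j-odd))
        (λ {d} d∣r+1 d∣c+1 → subst (d ∣_) g≡2 (gcd-greatest d∣r+1 d∣c+1)))
      singular)
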